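{- (a) For every integer $n\ge 1$, \[ \sigma(n)+\sigma_o(n)+2\sum_{k\ge 1}(-1)^k\delta_s(k)\big(\sigma(n-k)+\sigma_o(n-k)\big)=2(-1)^{n+1}n\,\delta_s(n). \] (b) For every integer $n\ge 1$, \[ \sum_{k=1}^{n}\big(\sigma_o(k)-\sigma_e(k)\big)\delta_t(n-k)=n\,\delta_t(n). \] (c) For every integer $n\ge 2$, \[ \sigma(n)+\sigma_s(n)+2\sum_{k\ge 1}(-1)^k\delta_s(k)\big(\sigma(n-k)+\sigma_s(n-k)\big)=2(-1)^{n+1}n\,\delta_s(n). \]
   Context: $\sigma(n)$ is the sum of positive divisors of $n$, $\sigma_o(n)$ (resp. $\sigma_e(n)$) the sum of odd (resp. even) positive divisors of $n$, and $\sigma_s(n)=\sum_{d\mid n}(-1)^{d-1}\frac{n}{d}$; all these are taken to be $0$ at arguments $\le 0$. $\delta_s(n)=1$ if $n$ is a perfect square and $0$ otherwise; $\delta_t(n)=1$ if $n=\frac{m(m+1)}{2}$ for some integer $m\ge0$ and $0$ otherwise. -}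

module Defs where

open import Data.Nat as ℕ using (ℕ; zero; suc; _∸_; _≟_; _*_)
open import Data.Nat.Divisibility using (_∣?_)
open import Data.Nat.DivMod using (_/_)
open import Data.Integer as ℤ using (ℤ; +_; -_)
open import Data.List using (List; filter; map; upTo)
open import Data.Nat.ListAction using (sum)
open import Data.Bool.ListAction using (any)
open import Data.Bool using (Bool; true; false; if_then_else_; not)
open import Relation.Nullary.Decidable using (⌊_⌋)
open import Data.Nat.Base using (NonZero)

sumFrom1 : ℕ → (ℕ → ℤ) → ℤ
sumFrom1 zero    f = + 0
sumFrom1 (suc n) f = sumFrom1 n f ℤ.+ f (suc n)

-- positive divisors of n (empty list for n = 0)
divisors : ℕ → List ℕ
divisors n = filter (λ d → d ∣? n) (map suc (upTo n))

sgn : ℕ → ℤ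
sgn zero          = + 1
sgn (suc zero)    = - (+ 1)
sgn (suc (suc m)) = sgn m

isEven : ℕ → Bool
isEven zero          = true
isEven (suc zero)    = false
isEven (suc (suc m)) = isEven m

-- σ, σ_o, σ_e, σ_s (all 0 at argument 0, since there are no divisors)
σ : ℕ → ℤ
σ n = + sum (divisors n)

σo : ℕ → ℤ
σo n = + sum (filter (λ d → not (isEven d) Data.Bool.≟ true) (divisors n))

σe : ℕ → ℤ
σe n = + sum (filter (λ d → isEven d Data.Bool.≟ true) (divisors n))

σs : ℕ → ℤ
σs n = sumList (map (λ d → sgn (d ∸ 1) ℤ.* (+ quot n d)) (divisors n))
  where
  sumList : List ℤ → ℤ
  sumList Data.List.[] = + 0
  sumList (x Data.List.∷ xs) = x ℤ.+ sumList xs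
  quot : ℕ → ℕ → ℕ
  quot n zero = 0
  quot n (suc d) = n / suc d

-- δ_s(n) = 1 iff n = m² for some m ≥ 0 (search m ≤ n suffices)
δs : ℕ → ℤ
δs n = if any (λ m → ⌊ m * m ≟ n ⌋) (upTo (suc n)) then + 1 else + 0

-- δ_t(n) = 1 iff n = m(m+1)/2 for some m ≥ 0, i.e. 2n = m(m+1)
δt : ℕ → ℤ
δt n = if any (λ m → ⌊ m * suc m ≟ 2 * n ⌋) (upTo (suc n)) then + 1 else + 0

{-# OPTIONS --safe #-}

-- All three identities evaluate S = Σ (−1)^d (1 − (−1)^(ε+e)) d over the triples i ∈ ℤ, d, e ≥ 1
-- with i(i+ε) + de = N: (a) and (c) are ε = 0, N = n (note σ_s = σ_o), and (b) is ε = 1, N = 2n.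
-- The evaluation is in the style of Liouville. By the symmetry i ↦ −ε−i, the factor d may be replaced
-- by d + i + ε/2. This new weight changes sign under (i , d , e) ↦ (e−ε−i , d+2i+ε−e , e), so the
-- triples with d+2i+ε−e > 0 cancel. Those with d+2i+ε−e < 0 are carried by
-- (i , d , e) ↦ (i+d , d , e−2i−ε−d) to those with e+2i+ε−d > 0, with weight ((−1)^d − (−1)^e)(i + ε/2).
-- This weight sums to 0 over all triples and is invariant under (i , d , e) ↦ (−ε−i , e , d), which
-- reverses the sign of e+2i+ε−d, so again only the boundary counts. Boundary triples exist only if N = r(r+ε), are then parametrised
-- by d + e = 2r+ε, and contribute −2N.

module Submission where

open import Defs
open import Data.Nat using (ℕ; _≤_; _∸_)
open import Data.Integer using (ℤ; +_; _+_; _*_)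
open import Data.Product using (_×_)
open import Relation.Binary.PropositionalEquality using (_≡_)

import Data.Nat as ℕ
import Data.Nat.Properties as ℕ
import Data.Nat.Tactic.RingSolver as ℕ-Solver
import Data.Integer as ℤ
import Data.Integer.Properties as ℤ
import Data.List.Relation.Unary.All as All
import Data.List.Relation.Unary.All.Properties as All
import Data.List.Relation.Unary.AllPairs as AllPairs
import Data.List.Relation.Unary.AllPairs.Properties as AllPairs
import Data.List.Relation.Unary.Unique.Propositional.Properties as Unique
open import Algebra.Properties.AbelianGroup ℤ.+-0-abelianGroup using (∙-cancelˡ)
open import Data.Bool using (true; false; not; if_then_else_; T)
open import Data.Bool.ListAction using (any)
open import Data.Empty using (⊥-elim)
open import Data.Integer using (-_; _-_; 0ℤ; 1ℤ)
open import Data.Integer.Tactic.RingSolver using (solve-∀)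
open import Data.List using (List; []; _∷_; _++_; map; filter; concat; upTo)
open import Data.List.Membership.Propositional using (_∈_; lose; find)
open import Data.List.Membership.Propositional.Properties
  using (∈-map⁺; ∈-map⁻; ∈-++⁺ˡ; ∈-++⁺ʳ; ∈-concat⁺′; ∈-concat⁻′; ∈-filter⁺; ∈-filter⁻; ∈-upTo⁺; ∈-upTo⁻)
open import Data.List.Membership.Propositional.Properties.WithK using (unique∧set⇒bag)
open import Data.List.Properties using (upTo-∷ʳ; map-upTo)
open import Data.List.Relation.Binary.BagAndSetEquality using (∼bag⇒↭)
open import Data.List.Relation.Binary.Permutation.Propositional as ↭ using (_↭_)
open import Data.List.Relation.Unary.AllPairs using ([]; _∷_)
open import Data.List.Relation.Unary.Any using (here; there)
open import Data.List.Relation.Unary.Any.Properties using (any⁺; any⁻)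
open import Data.List.Relation.Unary.Unique.Propositional using (Unique)
open import Data.Nat.Divisibility using (_∣_; _∣?_; divides)
open import Data.Nat.DivMod using (_/_; m*[n/m]≡n; m*n/n≡m)
open import Data.Nat.ListAction using (sum)
open import Data.Product using (∃; _,_; proj₁; proj₂)
open import Data.Sum using (_⊎_; inj₁; inj₂)
open import Function using (_∘_; mk⇔)
open import Relation.Binary.Definitions using (tri<; tri≈; tri>)
open import Relation.Binary.PropositionalEquality
  using (refl; sym; trans; cong; cong₂; subst; _≢_; module ≡-Reasoning)
open import Relation.Nullary using (¬_; yes; no)
open import Relation.Nullary.Decidable using (⌊_⌋; toWitness; fromWitness)
open import Relation.Unary using (Decidable)
open ≡-Reasoning

-- The factor 1 - (-1)^(ε+e) is what makes the first involution odd: it keeps only triples with ε +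
-- e odd, and for those the step from d to d + 2i + ε - e flips (-1)^d. The obstacle is that the new
-- d must again be positive, so the map acts on a part of the triples only, and the rest must be
-- evaluated through a second weight. Half-integers are avoided by doubling, so the relation between
-- the sum and its boundary is stated for 4S. The convolutions appear when S is summed along i: the
-- fibre over i is a divisor sum at N - i(i+ε), and the indices i and -ε - i have equal fibres. For
-- ε = 0 only i = 0 is unpaired, which gives the leading term and the factor 2 of (a) and (c); for ε
-- = 1 every triangular number is met exactly twice.

private
  variable
    X Y : Set

-- Finite sums

∑ : List X → (X → ℤ) → ℤ
∑ []       f = + 0
∑ (x ∷ xs) f = f x + ∑ xs f

∑-cong : {f g : X → ℤ} (xs : List X) → (∀ x → x ∈ xs → f x ≡ g x) → ∑ xs f ≡ ∑ xs g
∑-cong []       h = refl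
∑-cong (x ∷ xs) h = cong₂ _+_ (h x (here refl)) (∑-cong xs (λ y y∈ → h y (there y∈)))

∑-+ : (xs : List X) (f g : X → ℤ) → ∑ xs (λ x → f x + g x) ≡ ∑ xs f + ∑ xs g
∑-+ []       f g = refl
∑-+ (x ∷ xs) f g = trans (cong (λ t → f x + g x + t) (∑-+ xs f g)) (interchange (f x) (g x) (∑ xs f) (∑ xs g))
  where
  interchange : ∀ a b c d → a + b + (c + d) ≡ a + c + (b + d)
  interchange = solve-∀

∑-*ˡ : (c : ℤ) (xs : List X) (f : X → ℤ) → ∑ xs (λ x → c * f x) ≡ c * ∑ xs f
∑-*ˡ c []       f = sym (ℤ.*-zeroʳ c)
∑-*ˡ c (x ∷ xs) f = trans (cong (λ t → c * f x + t) (∑-*ˡ c xs f)) (sym (ℤ.*-distribˡ-+ c (f x) (∑ xs f)))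

∑-0 : {f : X → ℤ} (xs : List X) → (∀ x → x ∈ xs → f x ≡ 0ℤ) → ∑ xs f ≡ 0ℤ
∑-0 []       h = refl
∑-0 (x ∷ xs) h = cong₂ _+_ (h x (here refl)) (∑-0 xs (λ y y∈ → h y (there y∈)))

∑-map : (φ : X → Y) (xs : List X) (f : Y → ℤ) → ∑ (map φ xs) f ≡ ∑ xs (f ∘ φ)
∑-map φ []       f = refl
∑-map φ (x ∷ xs) f = cong (λ t → f (φ x) + t) (∑-map φ xs f)

∑-++ : (xs ys : List X) (f : X → ℤ) → ∑ (xs ++ ys) f ≡ ∑ xs f + ∑ ys f
∑-++ []       ys f = sym (ℤ.+-identityˡ _)
∑-++ (x ∷ xs) ys f = trans (cong (λ t → f x + t) (∑-++ xs ys f)) (sym (ℤ.+-assoc (f x) _ _))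

∑-concat-map : (g : X → List Y) (xs : List X) (f : Y → ℤ) →
               ∑ (concat (map g xs)) f ≡ ∑ xs (λ x → ∑ (g x) f)
∑-concat-map g []       f = refl
∑-concat-map g (x ∷ xs) f =
  trans (∑-++ (g x) _ f) (cong (λ t → ∑ (g x) f + t) (∑-concat-map g xs f))

∑-↭ : {xs ys : List X} (f : X → ℤ) → xs ↭ ys → ∑ xs f ≡ ∑ ys f
∑-↭ f ↭.refl           = refl
∑-↭ f (↭.prep x p)     = cong (λ t → f x + t) (∑-↭ f p)
∑-↭ f (↭.swap {xs} {ys} x y p) = trans (cong (λ t → f x + (f y + t)) (∑-↭ f p)) (exchange (f x) (f y) (∑ ys f))
  where
  exchange : ∀ a b c → a + (b + c) ≡ b + (a + c)
  exchange = solve-∀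
∑-↭ f (↭.trans p q)    = trans (∑-↭ f p) (∑-↭ f q)

-- Two functions are allowed because a factor such as `1ℤ + sgn e` vanishes off the filter and
-- becomes the constant 2 on it.
∑-filter : {P : X → Set} (P? : Decidable P) (xs : List X) {f g : X → ℤ} →
           (∀ x → x ∈ xs → P x → f x ≡ g x) → (∀ x → x ∈ xs → ¬ P x → f x ≡ 0ℤ) →
           ∑ xs f ≡ ∑ (filter P? xs) g
∑-filter P? []       p n = refl
∑-filter P? (x ∷ xs) p n with P? x
... | yes px = cong₂ _+_ (p x (here refl) px) (∑-filter P? xs (λ y → p y ∘ there) (λ y → n y ∘ there))
... | no ¬px = trans (cong₂ _+_ (n x (here refl) ¬px) (∑-filter P? xs (λ y → p y ∘ there) (λ y → n y ∘ there)))
                     (ℤ.+-identityˡ _)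

∑-suc-upTo : ∀ n (f : ℕ → ℤ) → ∑ (map ℕ.suc (upTo n)) f ≡ sumFrom1 n f
∑-suc-upTo ℕ.zero    f = refl
∑-suc-upTo (ℕ.suc n) f = begin
  ∑ (map ℕ.suc (upTo (ℕ.suc n))) f                   ≡⟨ ∑-map ℕ.suc (upTo (ℕ.suc n)) f ⟩
  ∑ (upTo (ℕ.suc n)) (f ∘ ℕ.suc)                     ≡⟨ cong (λ xs → ∑ xs (f ∘ ℕ.suc)) (upTo-∷ʳ n) ⟨
  ∑ (upTo n ++ n ∷ []) (f ∘ ℕ.suc)                   ≡⟨ ∑-++ (upTo n) _ (f ∘ ℕ.suc) ⟩
  ∑ (upTo n) (f ∘ ℕ.suc) + (f (ℕ.suc n) + 0ℤ)        ≡⟨ cong₂ _+_ (sym (∑-map ℕ.suc (upTo n) f)) (ℤ.+-identityʳ _) ⟩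
  ∑ (map ℕ.suc (upTo n)) f + f (ℕ.suc n)             ≡⟨ cong (_+ f (ℕ.suc n)) (∑-suc-upTo n f) ⟩
  sumFrom1 n f + f (ℕ.suc n)                         ∎

∑-upTo : ∀ n (f : ℕ → ℤ) → ∑ (upTo (ℕ.suc n)) f ≡ f 0 + sumFrom1 n f
∑-upTo n f = trans (cong (λ xs → f 0 + ∑ xs f) (sym (map-upTo ℕ.suc n))) (cong (λ t → f 0 + t) (∑-suc-upTo n f))

-- Enumerations of finite sets and change of variables

record Enumeration (P : X → Set) : Set where
  field
    list     : List X
    unique   : Unique list
    sound    : ∀ x → x ∈ list → P x
    complete : ∀ x → P x → x ∈ list

open Enumeration

-- Injectivity is asked on the entries only: a map such as `n ∸_` is injective just on the range
-- that is summed over.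
Unique-map : {xs : List X} (φ : X → Y) → (∀ x y → x ∈ xs → y ∈ xs → φ x ≡ φ y → x ≡ y) →
             Unique xs → Unique (map φ xs)
Unique-map φ inj []           = []
Unique-map φ inj (x∉xs ∷ xs!) =
  All.map⁺ (All.tabulate (λ {y} y∈ φx≡φy → All.lookup x∉xs y∈ (inj _ y (here refl) (there y∈) φx≡φy)))
  ∷ Unique-map φ (λ x y x∈ y∈ → inj x y (there x∈) (there y∈)) xs!

mapᴱ : {P : X → Set} {Q : Y → Set} (E : Enumeration P) (φ : X → Y) →
       (∀ x y → P x → P y → φ x ≡ φ y → x ≡ y) →
       (∀ x → P x → Q (φ x)) →
       (∀ y → Q y → ∃ λ x → P x × φ x ≡ y) → Enumeration Q
mapᴱ {Q = Q} E φ inj to from = record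
  { list     = map φ (list E)
  ; unique   = Unique-map φ (λ x y x∈ y∈ → inj x y (sound E x x∈) (sound E y y∈)) (unique E)
  ; sound    = image
  ; complete = λ y qy → let x , px , φx≡y = from y qy in
                 subst (_∈ map φ (list E)) φx≡y (∈-map⁺ φ (complete E x px))
  }
  where
  image : ∀ y → y ∈ map φ (list E) → Q y
  image y y∈ with x , x∈ , refl ← ∈-map⁻ φ y∈ = to x (sound E x x∈)

-- Duplicate-free lists with the same members are permutations of each other, so a sum depends on
-- the predicate alone. This lets every bijection be checked on predicates instead of lists.
∑-independent : {P : X → Set} (E F : Enumeration P) (f : X → ℤ) → ∑ (list E) f ≡ ∑ (list F) f
∑-independent E F f = ∑-↭ f (∼bag⇒↭ (unique∧set⇒bag (unique E) (unique F)
  (mk⇔ (λ x∈ → complete F _ (sound E _ x∈)) (λ x∈ → complete E _ (sound F _ x∈)))))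

∑-reindex : {P : X → Set} {Q : Y → Set} (E : Enumeration P) (F : Enumeration Q) (φ : X → Y) →
            (∀ x y → P x → P y → φ x ≡ φ y → x ≡ y) →
            (∀ x → P x → Q (φ x)) →
            (∀ y → Q y → ∃ λ x → P x × φ x ≡ y) →
            (f : Y → ℤ) → ∑ (list E) (f ∘ φ) ≡ ∑ (list F) f
∑-reindex E F φ inj to from f =
  trans (sym (∑-map φ (list E) f)) (∑-independent (mapᴱ E φ inj to from) F f)

upToᴱ : ∀ n → Enumeration (ℕ._< n)
upToᴱ n = record
  { list     = upTo n
  ; unique   = Unique.upTo⁺ n
  ; sound    = λ _ → ∈-upTo⁻
  ; complete = λ _ → ∈-upTo⁺
  }

rangeᴱ : ∀ n → Enumeration (λ k → 1 ≤ k × k ≤ n)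
rangeᴱ n = mapᴱ (upToᴱ n) ℕ.suc (λ _ _ _ _ → ℕ.suc-injective) (λ _ k<n → ℕ.s≤s ℕ.z≤n , k<n)
  (λ { (ℕ.suc k) (_ , k<n) → k , k<n , refl })

filterᴱ : {P Q : X → Set} → Decidable Q → Enumeration P → Enumeration (λ x → P x × Q x)
filterᴱ Q? E = record
  { list     = filter Q? (list E)
  ; unique   = Unique.filter⁺ Q? (unique E)
  ; sound    = λ x x∈ → let x∈E , qx = ∈-filter⁻ Q? x∈ in sound E x x∈E , qx
  ; complete = λ { x (px , qx) → ∈-filter⁺ Q? (complete E x px) qx }
  }

sigmaᴱ : {P : X → Set} {Q : X → Y → Set} → Enumeration P → (∀ x → Enumeration (Q x)) →
         Enumeration {X × Y} (λ { (x , y) → P x × Q x y })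
sigmaᴱ {X = X} {Y = Y} {P} {Q} E F = record
  { list     = concat (map fibre (list E))
  ; unique   = Unique.concat⁺ (All.map⁺ (All.tabulate (λ {x} _ → Unique.map⁺ (cong proj₂) (unique (F x)))))
                 (AllPairs.map⁺ (AllPairs.map disjoint (unique E)))
  ; sound    = from-fibre
  ; complete = λ { (x , y) (px , qy) → ∈-concat⁺′ (∈-map⁺ (x ,_) (complete (F x) y qy)) (∈-map⁺ fibre (complete E x px)) }
  }
  where
  fibre : X → List (X × Y)
  fibre x = map (x ,_) (list (F x))
  disjoint : ∀ {x y} → x ≢ y → ∀ {v} → ¬ (v ∈ fibre x × v ∈ fibre y)
  disjoint x≢y (v∈ , v∈′) with ∈-map⁻ _ v∈ | ∈-map⁻ _ v∈′
  ... | _ , _ , refl | _ , _ , refl = x≢y refl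
  from-fibre : ∀ z → z ∈ concat (map fibre (list E)) → P (proj₁ z) × Q (proj₁ z) (proj₂ z)
  from-fibre z z∈ with ∈-concat⁻′ (map fibre (list E)) z∈
  ... | zs , z∈zs , zs∈ with ∈-map⁻ fibre zs∈
  ... | x , x∈ , refl with ∈-map⁻ _ z∈zs
  ... | y , y∈ , refl = sound E x x∈ , sound (F x) y y∈

∑-sigma : {P : X → Set} {Q : X → Y → Set} (E : Enumeration P) (F : ∀ x → Enumeration (Q x)) (f : X × Y → ℤ) →
          ∑ (list (sigmaᴱ {Q = Q} E F)) f ≡ ∑ (list E) (λ x → ∑ (list (F x)) (λ y → f (x , y)))
∑-sigma E F f = trans (∑-concat-map _ (list E) f)
  (∑-cong (list E) (λ x _ → ∑-map (x ,_) (list (F x)) f))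

-- Parity signs

sgn-suc : ∀ n → sgn (ℕ.suc n) ≡ - sgn n
sgn-suc ℕ.zero            = refl
sgn-suc (ℕ.suc ℕ.zero)    = refl
sgn-suc (ℕ.suc (ℕ.suc n)) = sgn-suc n

sgn-+ : ∀ m n → sgn (m ℕ.+ n) ≡ sgn m * sgn n
sgn-+ ℕ.zero    n = sym (ℤ.*-identityˡ (sgn n))
sgn-+ (ℕ.suc m) n = begin
  sgn (ℕ.suc (m ℕ.+ n))   ≡⟨ sgn-suc (m ℕ.+ n) ⟩
  - sgn (m ℕ.+ n)         ≡⟨ cong -_ (sgn-+ m n) ⟩
  - (sgn m * sgn n)       ≡⟨ ℤ.neg-distribˡ-* (sgn m) (sgn n) ⟩
  - sgn m * sgn n         ≡⟨ cong (_* sgn n) (sgn-suc m) ⟨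
  sgn (ℕ.suc m) * sgn n   ∎

sgn-square : ∀ n → sgn n * sgn n ≡ 1ℤ
sgn-square ℕ.zero            = refl
sgn-square (ℕ.suc ℕ.zero)    = refl
sgn-square (ℕ.suc (ℕ.suc n)) = sgn-square n

sgn-2* : ∀ n → sgn (2 ℕ.* n) ≡ 1ℤ
sgn-2* n = trans (cong (λ m → sgn (n ℕ.+ m)) (ℕ.+-identityʳ n)) (trans (sgn-+ n n) (sgn-square n))

par : ℤ → ℤ
par i = sgn ℤ.∣ i ∣

par-⊖ : ∀ m n → par (m ℤ.⊖ n) ≡ sgn m * sgn n
par-⊖ m         ℕ.zero    = sym (ℤ.*-identityʳ (sgn m))
par-⊖ ℕ.zero    (ℕ.suc n) = sym (ℤ.*-identityˡ (sgn (ℕ.suc n)))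
par-⊖ (ℕ.suc m) (ℕ.suc n) = begin
  par (ℕ.suc m ℤ.⊖ ℕ.suc n)       ≡⟨ cong par (ℤ.[1+m]⊖[1+n]≡m⊖n m n) ⟩
  par (m ℤ.⊖ n)                   ≡⟨ par-⊖ m n ⟩
  sgn m * sgn n                   ≡⟨ neg*neg (sgn m) (sgn n) ⟩
  - sgn m * - sgn n               ≡⟨ cong₂ _*_ (sgn-suc m) (sgn-suc n) ⟨
  sgn (ℕ.suc m) * sgn (ℕ.suc n)   ∎
  where
  neg*neg : ∀ x y → x * y ≡ - x * - y
  neg*neg = solve-∀

par-+ : ∀ i j → par (i + j) ≡ par i * par j
par-+ (+ m)        (+ n)        = sgn-+ m n
par-+ (+ m)        (ℤ.-[1+ n ]) = par-⊖ m (ℕ.suc n)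
par-+ (ℤ.-[1+ m ]) (+ n)        = trans (par-⊖ n (ℕ.suc m)) (ℤ.*-comm (sgn n) _)
par-+ (ℤ.-[1+ m ]) (ℤ.-[1+ n ]) =
  trans (cong (λ k → sgn (ℕ.suc k)) (sym (ℕ.+-suc m n))) (sgn-+ (ℕ.suc m) (ℕ.suc n))

par-square : ∀ i → par i * par i ≡ 1ℤ
par-square i = sgn-square ℤ.∣ i ∣

-- The parity computations of the descent write a new coordinate as a combination of old ones plus a
-- doubled term, which this discards.
par-+-even : ∀ i j → par (i + (j + j)) ≡ par i
par-+-even i j = begin
  par (i + (j + j))         ≡⟨ par-+ i (j + j) ⟩
  par i * par (j + j)       ≡⟨ cong (par i *_) (trans (par-+ j j) (par-square j)) ⟩
  par i * 1ℤ                ≡⟨ ℤ.*-identityʳ _ ⟩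
  par i                     ∎

i≡-i⇒i≡0 : ∀ {i} → i ≡ - i → i ≡ 0ℤ
i≡-i⇒i≡0 {+ ℕ.zero} eq = refl

-- Splitting by sign, and sums over involutions

∑-sign : (c : X → ℤ) (xs : List X) (f : X → ℤ) →
         ∑ xs f ≡ ∑ (filter (λ x → 0ℤ ℤ.<? c x) xs) f
                + ∑ (filter (λ x → c x ℤ.≟ 0ℤ) xs) f
                + ∑ (filter (λ x → c x ℤ.<? 0ℤ) xs) f
∑-sign c []       f = refl
∑-sign c (x ∷ xs) f = step
  where
  p = ∑ (filter (λ x → 0ℤ ℤ.<? c x) xs) f
  q = ∑ (filter (λ x → c x ℤ.≟ 0ℤ) xs) f
  r = ∑ (filter (λ x → c x ℤ.<? 0ℤ) xs) f
  to-first : ∀ a p q r → a + (p + q + r) ≡ a + p + q + r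
  to-first = solve-∀
  to-second : ∀ a p q r → a + (p + q + r) ≡ p + (a + q) + r
  to-second = solve-∀
  to-third : ∀ a p q r → a + (p + q + r) ≡ p + q + (a + r)
  to-third = solve-∀
  step : ∑ (x ∷ xs) f ≡ ∑ (filter (λ x → 0ℤ ℤ.<? c x) (x ∷ xs)) f
                      + ∑ (filter (λ x → c x ℤ.≟ 0ℤ) (x ∷ xs)) f
                      + ∑ (filter (λ x → c x ℤ.<? 0ℤ) (x ∷ xs)) f
  -- The three decisions drive the three filters independently; the trichotomy refutes the case in
  -- which all of them fail.
  step with 0ℤ ℤ.<? c x | c x ℤ.≟ 0ℤ | c x ℤ.<? 0ℤ | ℤ.<-cmp (c x) 0ℤ
  ... | yes _  | no _   | no _   | _            = trans (cong (λ t → f x + t) (∑-sign c xs f)) (to-first (f x) p q r)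
  ... | no _   | yes _  | no _   | _            = trans (cong (λ t → f x + t) (∑-sign c xs f)) (to-second (f x) p q r)
  ... | no _   | no _   | yes _  | _            = trans (cong (λ t → f x + t) (∑-sign c xs f)) (to-third (f x) p q r)
  ... | yes c>0 | yes c≡0 | _      | _            = ⊥-elim (ℤ.<-irrefl (sym c≡0) c>0)
  ... | yes c>0 | no _   | yes c<0 | _            = ⊥-elim (ℤ.<-asym c>0 c<0)
  ... | no _   | yes c≡0 | yes c<0 | _            = ⊥-elim (ℤ.<-irrefl c≡0 c<0)
  ... | no _   | no _   | no c≮0 | tri< c<0 _ _ = ⊥-elim (c≮0 c<0)
  ... | no _   | no c≢0 | no _   | tri≈ _ c≡0 _ = ⊥-elim (c≢0 c≡0)
  ... | no c≯0 | no _   | no _   | tri> _ _ c>0 = ⊥-elim (c≯0 c>0)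

-- The two predicates may differ, since an involution of the whole type can exchange two regions,
-- such as `c₂` negative and `c₂` positive.
∑-involution : {P Q : X → Set} (E : Enumeration P) (F : Enumeration Q) (φ : X → X) →
               (∀ x → φ (φ x) ≡ x) → (∀ x → P x → Q (φ x)) → (∀ x → Q x → P (φ x)) →
               (f : X → ℤ) → ∑ (list E) (f ∘ φ) ≡ ∑ (list F) f
∑-involution E F φ inv to from = ∑-reindex E F φ
  (λ x y _ _ eq → trans (sym (inv x)) (trans (cong φ eq) (inv y)))
  to (λ y qy → φ y , from y qy , inv y)

-- The sum equals its own negative, hence vanishes in ℤ.
∑-odd : {P : X → Set} (E : Enumeration P) (φ : X → X) →
        (∀ x → φ (φ x) ≡ x) → (∀ x → P x → P (φ x)) →
        (f : X → ℤ) → (∀ x → f (φ x) ≡ - f x) → ∑ (list E) f ≡ 0ℤ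
∑-odd E φ inv to f odd = i≡-i⇒i≡0 (begin
  ∑ (list E) f                    ≡⟨ ∑-involution E E φ inv to to f ⟨
  ∑ (list E) (f ∘ φ)              ≡⟨ ∑-cong (list E) (λ x _ → trans (odd x) (sym (ℤ.-1*i≡-i (f x)))) ⟩
  ∑ (list E) (λ x → ℤ.-1ℤ * f x)  ≡⟨ ∑-*ˡ ℤ.-1ℤ (list E) f ⟩
  ℤ.-1ℤ * ∑ (list E) f            ≡⟨ ℤ.-1*i≡-i _ ⟩
  - ∑ (list E) f                  ∎)

-- Liouville descent on the triples

triple-≡ : {a b c a′ b′ c′ : ℤ} → a ≡ a′ → b ≡ b′ → c ≡ c′ → (a , b , c) ≡ (a′ , b′ , c′)
triple-≡ refl refl refl = refl

-- The coordinates d and e are integers with positivity as a side condition, so that the linear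
-- substitutions are verified by ring identities.
record Repr (ε N : ℤ) (x : ℤ × ℤ × ℤ) : Set where
  constructor repr
  private
    i = proj₁ x
    d = proj₁ (proj₂ x)
    e = proj₂ (proj₂ x)
  field
    d>0  : 0ℤ ℤ.< d
    e>0  : 0ℤ ℤ.< e
    eqn  : i * (i + ε) + d * e ≡ N

module Descent (ε N : ℤ) (A : Enumeration (Repr ε N)) where

  Triple : Set
  Triple = ℤ × ℤ × ℤ

  weight : Triple → ℤ
  weight (i , d , e) = par d * (1ℤ - par (ε + e))

  -- `c₁` is the new d under `τ`, and `c₂` the new e under `unshear`. `F` is `weight` times twice d
  -- + i + ε/2; `G` is what `F` becomes along `shear`; `G′` is `G` with d and e exchanged.
  c₁ c₂ F G G′ : Triple → ℤ
  c₁ (i , d , e) = d + (i + i) + ε - e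
  c₂ (i , d , e) = e + (i + i) + ε - d
  F (i , d , e) = weight (i , d , e) * (d + d + (i + i) + ε)
  G  (i , d , e) = (par d - par e) * (i + i + ε)
  G′ (i , d , e) = (par e - par d) * (i + i + ε)

  mirror : Triple → Triple
  mirror (i , d , e) = - i - ε , d , e

  mirror-Repr : ∀ x → Repr ε N x → Repr ε N (mirror x)
  mirror-Repr (i , d , e) (repr p q r) = repr p q (trans (lemma i d e ε) r)
    where
    lemma : ∀ i d e ε → (- i - ε) * (- i - ε + ε) + d * e ≡ i * (i + ε) + d * e
    lemma = solve-∀

  mirror-mirror : ∀ x → mirror (mirror x) ≡ x
  mirror-mirror (i , d , e) = triple-≡ (lemma i ε) refl refl
    where
    lemma : ∀ i ε → - (- i - ε) - ε ≡ i
    lemma = solve-∀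

  -- `mirror` fixes d and e and negates 2i + ε. This serves twice: it lets d be replaced by d + i +
  -- ε/2, and it makes the full sum of `G` zero.
  ∑-mirror-odd : (w : ℤ → ℤ → ℤ) → ∑ (list A) (λ { (i , d , e) → w d e * (i + i + ε) }) ≡ 0ℤ
  ∑-mirror-odd w = ∑-odd A mirror mirror-mirror mirror-Repr _
    (λ { (i , d , e) → lemma (w d e) i ε })
    where
    lemma : ∀ w i ε → w * ((- i - ε) + (- i - ε) + ε) ≡ - (w * (i + i + ε))
    lemma = solve-∀

  -- τ preserves d + i, hence the last factor of F.
  τ : Triple → Triple
  τ (i , d , e) = e - ε - i , d + (i + i) + ε - e , e

  -- `τ` exchanges d with `c₁`, so the conditions that d and `c₁` are positive trade places and the
  -- region is preserved.
  ∑F-c₁>0 : ∑ (filter (λ x → 0ℤ ℤ.<? c₁ x) (list A)) F ≡ 0ℤ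
  ∑F-c₁>0 = ∑-odd (filterᴱ (λ x → 0ℤ ℤ.<? c₁ x) A) τ inv to F odd
    where
    inv : ∀ x → τ (τ x) ≡ x
    inv (i , d , e) = triple-≡ (l₁ i e ε) (l₂ i d e ε) refl
      where
      l₁ : ∀ i e ε → e - ε - (e - ε - i) ≡ i
      l₁ = solve-∀
      l₂ : ∀ i d e ε → d + (i + i) + ε - e + (e - ε - i + (e - ε - i)) + ε - e ≡ d
      l₂ = solve-∀
    to : ∀ x → Repr ε N x × 0ℤ ℤ.< c₁ x → Repr ε N (τ x) × 0ℤ ℤ.< c₁ (τ x)
    to (i , d , e) (repr p q r , s) =
      repr s q (trans (l₁ i d e ε) r) , subst (0ℤ ℤ.<_) (sym (l₂ i d e ε)) p
      where
      l₁ : ∀ i d e ε → (e - ε - i) * (e - ε - i + ε) + (d + (i + i) + ε - e) * e ≡ i * (i + ε) + d * e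
      l₁ = solve-∀
      l₂ : ∀ i d e ε → d + (i + i) + ε - e + (e - ε - i + (e - ε - i)) + ε - e ≡ d
      l₂ = solve-∀
    odd : ∀ x → F (τ x) ≡ - F x
    odd (i , d , e) = begin
      par (d + (i + i) + ε - e) * (1ℤ - h) * W′  ≡⟨ cong₂ (λ p w → p * (1ℤ - h) * w) par-d′ (l₂ i d e ε) ⟩
      par d * h * (1ℤ - h) * W                   ≡⟨ l₃ (par d) h W ⟩
      -- Since h is a sign, h(1 - h) = -(1 - h): the factor h picked up by (-1)^d acts as -1.
      par d * (h - h * h) * W                    ≡⟨ cong (λ t → par d * (h - t) * W) (par-square (ε + e)) ⟩
      par d * (h - 1ℤ) * W                       ≡⟨ l₄ (par d) h W ⟩
      - (par d * (1ℤ - h) * W)                   ∎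
      where
      h  = par (ε + e)
      W  = d + d + (i + i) + ε
      W′ = d + (i + i) + ε - e + (d + (i + i) + ε - e) + (e - ε - i + (e - ε - i)) + ε
      l₁ : ∀ i d e ε → d + (i + i) + ε - e ≡ d + (ε + e) + ((i - e) + (i - e))
      l₁ = solve-∀
      l₂ : ∀ i d e ε → d + (i + i) + ε - e + (d + (i + i) + ε - e) + (e - ε - i + (e - ε - i)) + ε ≡ d + d + (i + i) + ε
      l₂ = solve-∀
      l₃ : ∀ p h w → p * h * (1ℤ - h) * w ≡ p * (h - h * h) * w
      l₃ = solve-∀
      l₄ : ∀ p h w → p * (h - 1ℤ) * w ≡ - (p * (1ℤ - h) * w)
      l₄ = solve-∀
      par-d′ : par (d + (i + i) + ε - e) ≡ par d * h
      par-d′ = trans (cong par (l₁ i d e ε)) (trans (par-+-even (d + (ε + e)) (i - e)) (par-+ d (ε + e)))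

  shear unshear : Triple → Triple
  shear   (i , d , e) = i + d , d , e - (i + i) - ε - d
  unshear (i , d , e) = i - d , d , e + (i + i) + ε - d

  -- Under `shear` the new e is -`c₁` and the new `c₂` is the old e, so the two inequalities trade
  -- places. The factor 2d + 2i + ε becomes 2i + ε, and the new e has the parity of d + ε + e, which
  -- turns the weight into a difference of two signs.
  ∑F-c₁<0 : ∑ (filter (λ x → c₁ x ℤ.<? 0ℤ) (list A)) F ≡ ∑ (filter (λ x → 0ℤ ℤ.<? c₂ x) (list A)) G
  ∑F-c₁<0 = trans (∑-cong (filter (λ x → c₁ x ℤ.<? 0ℤ) (list A)) (λ x _ → F≡G∘shear x))
    (∑-reindex (filterᴱ (λ x → c₁ x ℤ.<? 0ℤ) A) (filterᴱ (λ x → 0ℤ ℤ.<? c₂ x) A) shear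
      (λ x y _ _ eq → trans (sym (unshear-shear x)) (trans (cong unshear eq) (unshear-shear y)))
      to (λ y qy → unshear y , from y qy , shear-unshear y) G)
    where
    F≡G∘shear : ∀ x → F x ≡ G (shear x)
    F≡G∘shear (i , d , e) = begin
      par d * (1ℤ - par (ε + e)) * (d + d + (i + i) + ε)
        ≡⟨ l₁ (par d) (par (ε + e)) i d ε ⟩
      (par d - par d * par (ε + e)) * (i + d + (i + d) + ε)
        ≡⟨ cong (λ t → (par d - t) * (i + d + (i + d) + ε)) par-Δ ⟨
      (par d - par (e - (i + i) - ε - d)) * (i + d + (i + d) + ε) ∎
      where
      l₁ : ∀ p h i d ε → p * (1ℤ - h) * (d + d + (i + i) + ε) ≡ (p - p * h) * (i + d + (i + d) + ε)
      l₁ = solve-∀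
      l₂ : ∀ i d e ε → e - (i + i) - ε - d ≡ d + (ε + e) + (- (i + ε + d) + - (i + ε + d))
      l₂ = solve-∀
      par-Δ : par (e - (i + i) - ε - d) ≡ par d * par (ε + e)
      par-Δ = trans (cong par (l₂ i d e ε)) (trans (par-+-even (d + (ε + e)) (- (i + ε + d))) (par-+ d (ε + e)))
    unshear-shear : ∀ x → unshear (shear x) ≡ x
    unshear-shear (i , d , e) = triple-≡ (l₁ i d) refl (l₂ i d e ε)
      where
      l₁ : ∀ i d → i + d - d ≡ i
      l₁ = solve-∀
      l₂ : ∀ i d e ε → e - (i + i) - ε - d + (i + d + (i + d)) + ε - d ≡ e
      l₂ = solve-∀
    shear-unshear : ∀ x → shear (unshear x) ≡ x
    shear-unshear (i , d , e) = triple-≡ (l₁ i d) refl (l₂ i d e ε)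
      where
      l₁ : ∀ i d → i - d + d ≡ i
      l₁ = solve-∀
      l₂ : ∀ i d e ε → e + (i + i) + ε - d - (i - d + (i - d)) - ε - d ≡ e
      l₂ = solve-∀
    to : ∀ x → Repr ε N x × c₁ x ℤ.< 0ℤ → Repr ε N (shear x) × 0ℤ ℤ.< c₂ (shear x)
    to (i , d , e) (repr p q r , s) =
      repr p (subst (0ℤ ℤ.<_) (l₁ i d e ε) (ℤ.neg-mono-< s)) (trans (l₂ i d e ε) r)
      , subst (0ℤ ℤ.<_) (sym (l₃ i d e ε)) q
      where
      l₁ : ∀ i d e ε → - (d + (i + i) + ε - e) ≡ e - (i + i) - ε - d
      l₁ = solve-∀
      l₂ : ∀ i d e ε → (i + d) * (i + d + ε) + d * (e - (i + i) - ε - d) ≡ i * (i + ε) + d * e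
      l₂ = solve-∀
      l₃ : ∀ i d e ε → e - (i + i) - ε - d + (i + d + (i + d)) + ε - d ≡ e
      l₃ = solve-∀
    from : ∀ x → Repr ε N x × 0ℤ ℤ.< c₂ x → Repr ε N (unshear x) × c₁ (unshear x) ℤ.< 0ℤ
    from (i , d , e) (repr p q r , s) =
      repr p s (trans (l₁ i d e ε) r) , subst (ℤ._< 0ℤ) (sym (l₂ i d e ε)) (ℤ.neg-mono-< q)
      where
      l₁ : ∀ i d e ε → (i - d) * (i - d + ε) + d * (e + (i + i) + ε - d) ≡ i * (i + ε) + d * e
      l₁ = solve-∀
      l₂ : ∀ i d e ε → d + (i - d + (i - d)) + ε - (e + (i + i) + ε - d) ≡ - e
      l₂ = solve-∀

  -- Under `ρ` both factors of `G` change sign, so `G` is unchanged, while `c₂` is negated.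
  ∑G-c₂<0 : ∑ (filter (λ x → c₂ x ℤ.<? 0ℤ) (list A)) G ≡ ∑ (filter (λ x → 0ℤ ℤ.<? c₂ x) (list A)) G
  ∑G-c₂<0 = trans (∑-cong (filter (λ x → c₂ x ℤ.<? 0ℤ) (list A)) (λ { (i , d , e) _ → l₁ (par d) (par e) i ε }))
    (∑-involution (filterᴱ (λ x → c₂ x ℤ.<? 0ℤ) A) (filterᴱ (λ x → 0ℤ ℤ.<? c₂ x) A) ρ
      (λ { (i , d , e) → triple-≡ (l₂ i ε) refl refl })
      (λ { (i , d , e) (repr p q r , s) → repr q p (trans (l₃ i d e ε) r) , subst (0ℤ ℤ.<_) (l₄ i d e ε) (ℤ.neg-mono-< s) })
      (λ { (i , d , e) (repr p q r , s) → repr q p (trans (l₃ i d e ε) r) , subst (ℤ._< 0ℤ) (l₄ i d e ε) (ℤ.neg-mono-< s) })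
      G)
    where
    ρ : Triple → Triple
    ρ (i , d , e) = - i - ε , e , d
    l₁ : ∀ p q i ε → (p - q) * (i + i + ε) ≡ (q - p) * (- i - ε + (- i - ε) + ε)
    l₁ = solve-∀
    l₂ : ∀ i ε → - (- i - ε) - ε ≡ i
    l₂ = solve-∀
    l₃ : ∀ i d e ε → (- i - ε) * (- i - ε + ε) + e * d ≡ i * (i + ε) + d * e
    l₃ = solve-∀
    l₄ : ∀ i d e ε → - (e + (i + i) + ε - d) ≡ d + (- i - ε + (- i - ε)) + ε - e
    l₄ = solve-∀

  Boundary : List Triple
  Boundary = filter (λ x → c₁ x ℤ.≟ 0ℤ) (list A)

  -- Exchanging d and e turns `c₂` into `c₁`, so both boundary sums live on one set.
  ∑G-c₂≡0 : ∑ (filter (λ x → c₂ x ℤ.≟ 0ℤ) (list A)) G ≡ ∑ Boundary G′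
  ∑G-c₂≡0 = ∑-involution (filterᴱ (λ x → c₂ x ℤ.≟ 0ℤ) A) (filterᴱ (λ x → c₁ x ℤ.≟ 0ℤ) A) swap
    (λ _ → refl)
    (λ { (i , d , e) (repr p q r , s) → repr q p (trans (lemma i d e ε) r) , s })
    (λ { (i , d , e) (repr p q r , s) → repr q p (trans (lemma i d e ε) r) , s })
    G′
    where
    swap : Triple → Triple
    swap (i , d , e) = i , e , d
    lemma : ∀ i d e ε → i * (i + ε) + e * d ≡ i * (i + ε) + d * e
    lemma = solve-∀

  -- The sum of `F` is 2S, and it also equals b + n because the region of positive `c₁` cancels. The
  -- regions of positive and negative `c₂` both carry n, so the vanishing total of `G` reads 2n + b′
  -- = 0. Doubling the first relation eliminates n.
  four-∑ : + 4 * ∑ (list A) (λ x → weight x * proj₁ (proj₂ x))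
           ≡ + 2 * ∑ Boundary F - ∑ Boundary G′
  four-∑ = begin
    + 4 * S                                  ≡⟨ l₁ S ⟩
    + 2 * (+ 2 * S + 0ℤ)                     ≡⟨ cong (+ 2 *_) ∑F ⟨
    + 2 * ∑ (list A) F                       ≡⟨ cong (+ 2 *_) (∑-sign c₁ (list A) F) ⟩
    + 2 * (p + b + n)                        ≡⟨ cong (λ t → + 2 * (t + b + n)) ∑F-c₁>0 ⟩
    + 2 * (0ℤ + b + n)                       ≡⟨ l₂ b n b′ ⟩
    + 2 * b - b′ + (n + b′ + n)              ≡⟨ cong (λ t → + 2 * b - b′ + t) ∑G ⟩
    + 2 * b - b′ + 0ℤ                        ≡⟨ ℤ.+-identityʳ _ ⟩
    + 2 * b - b′                             ∎
    where
    S = ∑ (list A) (λ x → weight x * proj₁ (proj₂ x))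
    p = ∑ (filter (λ x → 0ℤ ℤ.<? c₁ x) (list A)) F
    b = ∑ Boundary F
    b′ = ∑ Boundary G′
    n = ∑ (filter (λ x → c₁ x ℤ.<? 0ℤ) (list A)) F
    l₁ : ∀ s → + 4 * s ≡ + 2 * (+ 2 * s + 0ℤ)
    l₁ = solve-∀
    l₂ : ∀ b n b′ → + 2 * (0ℤ + b + n) ≡ + 2 * b - b′ + (n + b′ + n)
    l₂ = solve-∀
    ∑F : ∑ (list A) F ≡ + 2 * S + 0ℤ
    ∑F = begin
      ∑ (list A) F
        ≡⟨ ∑-cong (list A) (λ { (i , d , e) _ → l₃ (weight (i , d , e)) i d ε }) ⟩
      ∑ (list A) (λ x → + 2 * (weight x * proj₁ (proj₂ x)) + weight x * (proj₁ x + proj₁ x + ε))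
        ≡⟨ ∑-+ (list A) (λ x → + 2 * (weight x * proj₁ (proj₂ x))) (λ x → weight x * (proj₁ x + proj₁ x + ε)) ⟩
      ∑ (list A) (λ x → + 2 * (weight x * proj₁ (proj₂ x))) + ∑ (list A) (λ x → weight x * (proj₁ x + proj₁ x + ε))
        ≡⟨ cong₂ _+_ (∑-*ˡ (+ 2) (list A) (λ x → weight x * proj₁ (proj₂ x)))
                     (∑-mirror-odd (λ d e → par d * (1ℤ - par (ε + e)))) ⟩
      + 2 * S + 0ℤ ∎
      where
      l₃ : ∀ w i d ε → w * (d + d + (i + i) + ε) ≡ + 2 * (w * d) + w * (i + i + ε)
      l₃ = solve-∀
    ∑G : n + b′ + n ≡ 0ℤ
    ∑G = begin
      n + b′ + n
        ≡⟨ cong₂ (λ u v → u + b′ + v) ∑F-c₁<0 (trans ∑F-c₁<0 (sym ∑G-c₂<0)) ⟩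
      ∑ (filter (λ x → 0ℤ ℤ.<? c₂ x) (list A)) G + b′ + ∑ (filter (λ x → c₂ x ℤ.<? 0ℤ) (list A)) G
        ≡⟨ cong (λ t → ∑ (filter (λ x → 0ℤ ℤ.<? c₂ x) (list A)) G + t + ∑ (filter (λ x → c₂ x ℤ.<? 0ℤ) (list A)) G) ∑G-c₂≡0 ⟨
      _
        ≡⟨ ∑-sign c₂ (list A) G ⟨
      ∑ (list A) G
        ≡⟨ ∑-mirror-odd (λ d e → par d - par e) ⟩
      0ℤ ∎

-- Evaluation on the boundary

positive : ∀ {i} → 0ℤ ℤ.< i → ∃ λ n → i ≡ + ℕ.suc n
positive {+ ℕ.suc n} _                 = n , refl
positive {+ ℕ.zero}  (ℤ.+<+ ())

-- The map k ↦ k(k+ε) is strictly increasing on ℕ.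
pronic-injective : ∀ ε j k → j ℕ.* (j ℕ.+ ε) ≡ k ℕ.* (k ℕ.+ ε) → j ≡ k
pronic-injective ε j k eq with ℕ.<-cmp j k
... | tri< j<k _ _ = ⊥-elim (ℕ.<-irrefl eq (ℕ.*-mono-< j<k (ℕ.+-monoˡ-< ε j<k)))
... | tri≈ _ j≡k _ = j≡k
... | tri> _ _ k<j = ⊥-elim (ℕ.<-irrefl (sym eq) (ℕ.*-mono-< k<j (ℕ.+-monoˡ-< ε k<j)))

module Boundary (ε : ℕ) (ε≤1 : ε ≤ 1) (N : ℕ) (A : Enumeration (Repr (+ ε) (+ N))) where

  open Descent (+ ε) (+ N) A

  pronic : ∀ k → + k * (+ k + + ε) ≡ + (k ℕ.* (k ℕ.+ ε))
  pronic k = sym (ℤ.pos-* k (k ℕ.+ ε))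

  -- For ε ≤ 1 the right side -2(k+1) + ε is at most -1. Splitting on ε lets it compute to a
  -- negative constructor.
  no-negative : ∀ {ε} → ε ≤ 1 → ∀ a k → + ℕ.suc a ≢ ℤ.-[1+ k ] + ℤ.-[1+ k ] + + ε
  no-negative ℕ.z≤n           a k ()
  no-negative (ℕ.s≤s ℕ.z≤n) a k ()

  d+e-boundary : ∀ i d e → c₁ (i , d , e) ≡ 0ℤ → d + e ≡ (i + d) + (i + d) + + ε
  d+e-boundary i d e c≡0 = trans (cong (λ t → d + t) (sym (ℤ.i-j≡0⇒i≡j _ e c≡0))) (lemma i d (+ ε))
    where
    lemma : ∀ i d ε → d + (d + (i + i) + ε) ≡ i + d + (i + d) + ε
    lemma = solve-∀

  -- On the boundary e = d + 2i + ε, and i(i+ε) + d(d+2i+ε) factors as (i+d)(i+d+ε). Moreover 2(i+d)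
  -- + ε = d + e is positive, so i + d cannot be negative.
  root : ∀ x → Repr (+ ε) (+ N) x → c₁ x ≡ 0ℤ → ∃ λ k → proj₁ x + proj₁ (proj₂ x) ≡ + k × N ≡ k ℕ.* (k ℕ.+ ε)
  root (i , d , e) (repr d>0 e>0 eq) c≡0 with positive d>0 | positive e>0
  ... | a , refl | b , refl = nonneg (i + d) refl
    where
    e≡ : d + (i + i) + + ε ≡ e
    e≡ = ℤ.i-j≡0⇒i≡j _ _ c≡0
    l₂ : ∀ i d ε → (i + d) * (i + d + ε) ≡ i * (i + ε) + d * (d + (i + i) + ε)
    l₂ = solve-∀
    nonneg : ∀ y → i + d ≡ y → ∃ λ k → y ≡ + k × N ≡ k ℕ.* (k ℕ.+ ε)
    nonneg (+ k) y≡ = k , refl , ℤ.+-injective (begin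
      + N                                              ≡⟨ eq ⟨
      i * (i + + ε) + d * e                            ≡⟨ cong (λ t → i * (i + + ε) + d * t) e≡ ⟨
      i * (i + + ε) + d * (d + (i + i) + + ε)          ≡⟨ l₂ i d (+ ε) ⟨
      (i + d) * (i + d + + ε)                          ≡⟨ cong (λ t → t * (t + + ε)) y≡ ⟩
      + k * (+ k + + ε)                                ≡⟨ pronic k ⟩
      + (k ℕ.* (k ℕ.+ ε))                              ∎)
    nonneg ℤ.-[1+ k ] y≡ =
      ⊥-elim (no-negative ε≤1 _ k (trans (d+e-boundary i d e c≡0) (cong (λ t → t + t + + ε) y≡)))

  ∑-nonpronic : (∀ k → N ≢ k ℕ.* (k ℕ.+ ε)) → ∑ (list A) (λ x → weight x * proj₁ (proj₂ x)) ≡ 0ℤ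
  ∑-nonpronic h = ℤ.*-cancelˡ-≡ (+ 4) _ _ (trans four-∑ (cong₂ (λ u v → + 2 * u - v) (vanish F) (vanish G′)))
    where
    vanish : ∀ f → ∑ Boundary f ≡ 0ℤ
    vanish f = ∑-0 Boundary λ x x∈ → ⊥-elim
      (let r , c = sound (filterᴱ (λ x → c₁ x ℤ.≟ 0ℤ) A) x x∈ ; k , _ , eq = root x r c in h k eq)

  η : ℤ
  η = par (+ ε)

  -- The value of 2`F` - `G′` at the boundary triple with the given d, where M stands for 2r + ε;
  -- see `boundary-term`.
  summand : ℤ → ℕ → ℤ
  summand M d = + 2 * ((sgn d - 1ℤ) * M) - (η - 1ℤ) * sgn d * (M - (+ d + + d))

  -- Combines Σ (-1)^d = ((-1)^m - 1)/2 with Σ (-1)^d d = ((-1)^m (2m+1) - 1)/4, both over 1 ≤ d ≤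
  -- m. The factor 2 clears the denominators.
  ∑-summand : ∀ m M → + 2 * sumFrom1 m (summand M)
    ≡ (+ 3 - η) * M * (sgn m - 1ℤ) - + 4 * M * + m + (η - 1ℤ) * (sgn m * (+ m + + m + 1ℤ) - 1ℤ)
  ∑-summand ℕ.zero    M = base η M
    where
    base : ∀ η M → 0ℤ ≡ (+ 3 - η) * M * (1ℤ - 1ℤ) - + 4 * M * 0ℤ + (η - 1ℤ) * (1ℤ * (0ℤ + 0ℤ + 1ℤ) - 1ℤ)
    base = solve-∀
  ∑-summand (ℕ.suc m) M = begin
    + 2 * (sumFrom1 m (summand M) + summand M (ℕ.suc m))
      ≡⟨ ℤ.*-distribˡ-+ (+ 2) (sumFrom1 m (summand M)) _ ⟩
    + 2 * sumFrom1 m (summand M) + + 2 * summand M (ℕ.suc m)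
      ≡⟨ cong₂ _+_ (∑-summand m M) (cong (λ s → + 2 * (+ 2 * ((s - 1ℤ) * M) - (η - 1ℤ) * s * (M - (+ ℕ.suc m + + ℕ.suc m)))) (sgn-suc m)) ⟩
    _
      ≡⟨ step η M (sgn m) (+ m) ⟩
    (+ 3 - η) * M * (- sgn m - 1ℤ) - + 4 * M * + ℕ.suc m + (η - 1ℤ) * (- sgn m * (+ ℕ.suc m + + ℕ.suc m + 1ℤ) - 1ℤ)
      ≡⟨ cong (λ s → (+ 3 - η) * M * (s - 1ℤ) - + 4 * M * + ℕ.suc m + (η - 1ℤ) * (s * (+ ℕ.suc m + + ℕ.suc m + 1ℤ) - 1ℤ)) (sgn-suc m) ⟨
    (+ 3 - η) * M * (sgn (ℕ.suc m) - 1ℤ) - + 4 * M * + ℕ.suc m + (η - 1ℤ) * (sgn (ℕ.suc m) * (+ ℕ.suc m + + ℕ.suc m + 1ℤ) - 1ℤ) ∎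
    where
    step : ∀ η M s m →
      ((+ 3 - η) * M * (s - 1ℤ) - + 4 * M * m + (η - 1ℤ) * (s * (m + m + 1ℤ) - 1ℤ))
        + + 2 * (+ 2 * ((- s - 1ℤ) * M) - (η - 1ℤ) * - s * (M - (1ℤ + m + (1ℤ + m))))
      ≡ (+ 3 - η) * M * (- s - 1ℤ) - + 4 * M * (1ℤ + m) + (η - 1ℤ) * (- s * (1ℤ + m + (1ℤ + m) + 1ℤ) - 1ℤ)
    step = solve-∀

  -- d ↦ (r − d , d , 2r + ε − d) parametrises the boundary.
  module _ (r m : ℕ) (N≡ : N ≡ r ℕ.* (r ℕ.+ ε)) (M≡ : r ℕ.+ r ℕ.+ ε ≡ ℕ.suc m) where

    M : ℤ
    M = + r + + r + + ε

    M≡1+m : M ≡ + ℕ.suc m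
    M≡1+m = cong (λ k → + k) M≡

    -- Here m = 2r + ε - 1 is the largest d for which e = 2r + ε - d is still positive.
    ∑-boundary : ∀ f → ∑ (map ℕ.suc (upTo m)) (λ d → f (+ r - + d , + d , M - + d)) ≡ ∑ Boundary f
    ∑-boundary = ∑-reindex (rangeᴱ m) (filterᴱ (λ x → c₁ x ℤ.≟ 0ℤ) A) (λ d → + r - + d , + d , M - + d)
      (λ x y _ _ eq → ℤ.+-injective (cong (proj₁ ∘ proj₂) eq))
      (λ { d (1≤d , d≤m) →
        repr (ℤ.+<+ 1≤d) (M-d>0 d d≤m) (trans (l₁ (+ r) (+ d) (+ ε)) (trans (pronic r) (cong (λ k → + k) (sym N≡))))
        , l₂ (+ r) (+ d) (+ ε) })
      from
      where
      M-d>0 : ∀ d → d ≤ m → 0ℤ ℤ.< M - + d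
      M-d>0 d d≤m = subst (0ℤ ℤ.<_)
        (sym (trans (cong (_- + d) M≡1+m) (trans (ℤ.m-n≡m⊖n (ℕ.suc m) d) (ℤ.⊖-≥ (ℕ.m≤n⇒m≤1+n d≤m)))))
        (ℤ.+<+ (ℕ.m<n⇒0<n∸m (ℕ.s≤s d≤m)))
      l₁ : ∀ r d ε → (r - d) * (r - d + ε) + d * (r + r + ε - d) ≡ r * (r + ε)
      l₁ = solve-∀
      l₂ : ∀ r d ε → d + (r - d + (r - d)) + ε - (r + r + ε - d) ≡ 0ℤ
      l₂ = solve-∀
      from : ∀ x → Repr (+ ε) (+ N) x × c₁ x ≡ 0ℤ →
             ∃ λ d → (1 ≤ d × d ≤ m) × (+ r - + d , + d , M - + d) ≡ x
      from (i , d , e) (rep@(repr d>0 e>0 _) , c≡0)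
        with positive d>0 | positive e>0 | root _ rep c≡0 | d+e-boundary i d e c≡0
      ... | a , refl | b , refl | k , i+d≡k , N≡k | d+e≡
        -- The root read off from the triple is the given r, so d + e equals the fixed number M.
        with refl ← pronic-injective ε k r (trans (sym N≡k) N≡) =
          ℕ.suc a , (ℕ.s≤s ℕ.z≤n , subst (ℕ.suc a ≤_) a+b≡m (ℕ.m<m+n a (ℕ.s≤s ℕ.z≤n)))
        , triple-≡ (trans (cong (_- d) (sym i+d≡k)) (l₃ i d)) refl (trans (cong (_- d) (sym d+e≡M)) (l₄ d e))
        where
        d+e≡M : d + e ≡ M
        d+e≡M = trans d+e≡ (cong (λ t → t + t + + ε) i+d≡k)
        a+b≡m : a ℕ.+ ℕ.suc b ≡ m
        a+b≡m = ℕ.suc-injective (ℤ.+-injective (trans d+e≡M M≡1+m))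
        l₃ : ∀ i d → i + d - d ≡ i
        l₃ = solve-∀
        l₄ : ∀ d e → d + e - d ≡ e
        l₄ = solve-∀

    -- At these triples 2d + 2i + ε is the constant M, and ε + e has the parity of d, so `F` reduces
    -- to (-1)^d (1 - (-1)^d) M.
    boundary-term : ∀ d → let x = + r - + d , + d , M - + d in
                    + 2 * F x + ℤ.-1ℤ * G′ x ≡ summand M d
    boundary-term d = begin
      + 2 * (sgn d * (1ℤ - par (+ ε + (M - + d))) * (+ d + + d + (+ r - + d + (+ r - + d)) + + ε))
        + ℤ.-1ℤ * ((par (M - + d) - sgn d) * (+ r - + d + (+ r - + d) + + ε))
        ≡⟨ cong₂ (λ p q → + 2 * (sgn d * (1ℤ - p) * (+ d + + d + (+ r - + d + (+ r - + d)) + + ε))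
                     + ℤ.-1ℤ * ((q - sgn d) * (+ r - + d + (+ r - + d) + + ε))) par-ε+e par-e ⟩
      + 2 * (sgn d * (1ℤ - sgn d) * (+ d + + d + (+ r - + d + (+ r - + d)) + + ε))
        + ℤ.-1ℤ * ((η * sgn d - sgn d) * (+ r - + d + (+ r - + d) + + ε))
        ≡⟨ l₁ (sgn d) η (+ d) (+ r) (+ ε) ⟩
      + 2 * ((sgn d - sgn d * sgn d) * M) - (η - 1ℤ) * sgn d * (M - (+ d + + d))
        ≡⟨ cong (λ t → + 2 * ((sgn d - t) * M) - (η - 1ℤ) * sgn d * (M - (+ d + + d))) (sgn-square d) ⟩
      summand M d ∎
      where
      l₁ : ∀ s η d r ε → + 2 * (s * (1ℤ - s) * (d + d + (r - d + (r - d)) + ε)) + ℤ.-1ℤ * ((η * s - s) * (r - d + (r - d) + ε))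
                       ≡ + 2 * ((s - s * s) * (r + r + ε)) - (η - 1ℤ) * s * (r + r + ε - (d + d))
      l₁ = solve-∀
      l₂ : ∀ d r ε → r + r + ε - d ≡ ε + d + ((r - d) + (r - d))
      l₂ = solve-∀
      l₃ : ∀ d r ε → ε + (r + r + ε - d) ≡ d + ((ε + r - d) + (ε + r - d))
      l₃ = solve-∀
      par-e : par (M - + d) ≡ η * sgn d
      par-e = trans (cong par (l₂ (+ d) (+ r) (+ ε))) (trans (par-+-even (+ ε + + d) (+ r - + d)) (par-+ (+ ε) (+ d)))
      par-ε+e : par (+ ε + (M - + d)) ≡ sgn d
      par-ε+e = trans (cong par (l₃ (+ d) (+ r) (+ ε))) (par-+-even (+ d) (+ ε + + r - + d))

    -- Both sides are 0 for ε = 0 and 2 for ε = 1. Trading η for ε² lets the closed form end in M² -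
    -- ε² = 4r(r+ε) = 4N.
    2ε²≡1-η : + 2 * (+ ε * + ε) ≡ 1ℤ - η
    2ε²≡1-η = lemma ε≤1
      where
      lemma : ∀ {ε} → ε ≤ 1 → + 2 * (+ ε * + ε) ≡ 1ℤ - sgn ε
      lemma ℕ.z≤n           = refl
      lemma (ℕ.s≤s ℕ.z≤n) = refl

    sgn-m : sgn m ≡ - η
    sgn-m = begin
      sgn m                     ≡⟨ ℤ.neg-involutive (sgn m) ⟨
      - - sgn m                 ≡⟨ cong -_ (sgn-suc m) ⟨
      - sgn (ℕ.suc m)           ≡⟨ cong (λ k → - sgn k) M≡ ⟨
      - par (+ r + + r + + ε)   ≡⟨ cong (λ i → - par i) (ℤ.+-comm (+ r + + r) (+ ε)) ⟩
      - par (+ ε + (+ r + + r)) ≡⟨ cong -_ (par-+-even (+ ε) (+ r)) ⟩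
      - η                       ∎

    ∑-summand-boundary : + 2 * sumFrom1 m (summand M) ≡ + 2 * (- + 8 * + N)
    ∑-summand-boundary = begin
      + 2 * sumFrom1 m (summand M)
        ≡⟨ ∑-summand m M ⟩
      (+ 3 - η) * M * (sgn m - 1ℤ) - + 4 * M * + m + (η - 1ℤ) * (sgn m * (+ m + + m + 1ℤ) - 1ℤ)
        ≡⟨ cong₂ (λ s n → (+ 3 - η) * M * (s - 1ℤ) - + 4 * M * n + (η - 1ℤ) * (s * (n + n + 1ℤ) - 1ℤ)) sgn-m m≡ ⟩
      (+ 3 - η) * M * (- η - 1ℤ) - + 4 * M * (M - 1ℤ) + (η - 1ℤ) * (- η * (M - 1ℤ + (M - 1ℤ) + 1ℤ) - 1ℤ)
        ≡⟨ l₁ η M ⟩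
      (1ℤ - η * η) * (M - 1ℤ) + + 2 * (1ℤ - η) - + 4 * (M * M)
        ≡⟨ cong₂ (λ s t → (1ℤ - s) * (M - 1ℤ) + + 2 * t - + 4 * (M * M)) (sgn-square ε) (sym 2ε²≡1-η) ⟩
      (1ℤ - 1ℤ) * (M - 1ℤ) + + 2 * (+ 2 * (+ ε * + ε)) - + 4 * (M * M)
        ≡⟨ l₂ (+ r) (+ ε) ⟩
      + 2 * (- + 8 * (+ r * (+ r + + ε)))
        ≡⟨ cong (λ t → + 2 * (- + 8 * t)) (trans (pronic r) (cong (λ k → + k) (sym N≡))) ⟩
      + 2 * (- + 8 * + N) ∎
      where
      m≡ : + m ≡ M - 1ℤ
      m≡ = trans (l₀ (+ m)) (cong (_- 1ℤ) (sym M≡1+m))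
        where
        l₀ : ∀ m → m ≡ 1ℤ + m - 1ℤ
        l₀ = solve-∀
      l₁ : ∀ η M → (+ 3 - η) * M * (- η - 1ℤ) - + 4 * M * (M - 1ℤ) + (η - 1ℤ) * (- η * (M - 1ℤ + (M - 1ℤ) + 1ℤ) - 1ℤ)
                 ≡ (1ℤ - η * η) * (M - 1ℤ) + + 2 * (1ℤ - η) - + 4 * (M * M)
      l₁ = solve-∀
      l₂ : ∀ r ε → (1ℤ - 1ℤ) * (r + r + ε - 1ℤ) + + 2 * (+ 2 * (ε * ε)) - + 4 * ((r + r + ε) * (r + r + ε)) ≡ + 2 * (- + 8 * (r * (r + ε)))
      l₂ = solve-∀

    ∑-pronic : ∑ (list A) (λ x → weight x * proj₁ (proj₂ x)) ≡ - + 2 * + N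
    ∑-pronic = ℤ.*-cancelˡ-≡ (+ 4) _ _ (begin
      + 4 * ∑ (list A) (λ x → weight x * proj₁ (proj₂ x))
        ≡⟨ four-∑ ⟩
      + 2 * ∑ Boundary F - ∑ Boundary G′
        ≡⟨ cong₂ _+_ (sym (∑-*ˡ (+ 2) Boundary F)) (trans (sym (ℤ.-1*i≡-i _)) (sym (∑-*ˡ ℤ.-1ℤ Boundary G′))) ⟩
      ∑ Boundary (λ x → + 2 * F x) + ∑ Boundary (λ x → ℤ.-1ℤ * G′ x)
        ≡⟨ ∑-+ Boundary (λ x → + 2 * F x) (λ x → ℤ.-1ℤ * G′ x) ⟨
      ∑ Boundary (λ x → + 2 * F x + ℤ.-1ℤ * G′ x)
        ≡⟨ ∑-boundary (λ x → + 2 * F x + ℤ.-1ℤ * G′ x) ⟨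
      ∑ (map ℕ.suc (upTo m)) (λ d → + 2 * F (+ r - + d , + d , M - + d) + ℤ.-1ℤ * G′ (+ r - + d , + d , M - + d))
        ≡⟨ ∑-cong (map ℕ.suc (upTo m)) (λ d _ → boundary-term d) ⟩
      ∑ (map ℕ.suc (upTo m)) (summand M)
        ≡⟨ ∑-suc-upTo m (summand M) ⟩
      sumFrom1 m (summand M)
        ≡⟨ ℤ.*-cancelˡ-≡ (+ 2) _ _ ∑-summand-boundary ⟩
      - + 8 * + N
        ≡⟨ l (+ N) ⟩
      + 4 * (- + 2 * + N) ∎)
      where
      l : ∀ n → - + 8 * n ≡ + 4 * (- + 2 * n)
      l = solve-∀

-- Divisor sums

-- With both factors positive there is no pair for n = 0, in agreement with divisor sums being 0
-- there. Truncated subtraction later relies on this.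
Cofactors : ℕ → ℕ × ℕ → Set
Cofactors n (d , e) = 1 ≤ d × 1 ≤ e × d ℕ.* e ≡ n

-- Follows the clauses of the quotient local to `σs`, so that the two agree by `refl` after a split
-- on the divisor.
quotient : ℕ → ℕ → ℕ
quotient n ℕ.zero    = 0
quotient n (ℕ.suc d) = n / ℕ.suc d

-- Built on the very list `divisors n`, so sums over pairs and sums over divisors differ by `∑-map`
-- only.
cofactorsᴱ : ∀ n → Enumeration (Cofactors n)
cofactorsᴱ n = mapᴱ (filterᴱ (_∣? n) (rangeᴱ n)) (λ d → d , quotient n d)
  (λ _ _ _ _ → cong proj₁) to from
  where
  to : ∀ d → (1 ≤ d × d ≤ n) × d ∣ n → Cofactors n (d , quotient n d)
  to (ℕ.suc d) ((1≤d , d≤n) , d∣n) = 1≤d , 1≤q _ d*q , d*q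
    where
    d*q : ℕ.suc d ℕ.* (n / ℕ.suc d) ≡ n
    d*q = m*[n/m]≡n d∣n
    1≤q : ∀ q → ℕ.suc d ℕ.* q ≡ n → 1 ≤ q
    1≤q ℕ.zero    eq with () ← ℕ.≤-trans 1≤d (ℕ.≤-trans d≤n (ℕ.≤-reflexive (trans (sym eq) (ℕ.*-zeroʳ d))))
    1≤q (ℕ.suc q) eq = ℕ.s≤s ℕ.z≤n
  from : ∀ x → Cofactors n x → ∃ λ d → ((1 ≤ d × d ≤ n) × d ∣ n) × (d , quotient n d) ≡ x
  from (d@(ℕ.suc _) , e@(ℕ.suc _)) (1≤d , _ , refl) =
    d , ((1≤d , ℕ.m≤m*n d e) , divides e (ℕ.*-comm d e))
    , cong (d ,_) (trans (cong (_/ d) (ℕ.*-comm d e)) (m*n/n≡m e d))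

∑-cofactors : ∀ n f → ∑ (list (cofactorsᴱ n)) f ≡ ∑ (divisors n) (λ d → f (d , quotient n d))
∑-cofactors n f = ∑-map _ (divisors n) f

∑-swap : ∀ n f → ∑ (list (cofactorsᴱ n)) (λ { (d , e) → f (e , d) }) ≡ ∑ (list (cofactorsᴱ n)) f
∑-swap n f = ∑-involution (cofactorsᴱ n) (cofactorsᴱ n) swap (λ _ → refl) to to f
  where
  swap : ℕ × ℕ → ℕ × ℕ
  swap (d , e) = e , d
  to : ∀ x → Cofactors n x → Cofactors n (swap x)
  to (d , e) (1≤d , 1≤e , eq) = 1≤e , 1≤d , trans (ℕ.*-comm e d) eq

data Parity : ℕ → Set where
  even : ∀ k → Parity (2 ℕ.* k)
  odd  : ∀ k → Parity (ℕ.suc (2 ℕ.* k))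

parity : ∀ n → Parity n
parity ℕ.zero = even 0
parity (ℕ.suc n) with parity n
... | even k = odd k
... | odd k  = subst Parity (sym (lemma k)) (even (ℕ.suc k))
  where
  lemma : ∀ k → 2 ℕ.+ 2 ℕ.* k ≡ 2 ℕ.* ℕ.suc k
  lemma = ℕ-Solver.solve-∀

sgn-1+2* : ∀ k → sgn (ℕ.suc (2 ℕ.* k)) ≡ ℤ.-1ℤ
sgn-1+2* k = trans (sgn-suc (2 ℕ.* k)) (cong -_ (sgn-2* k))

-- The factor `1ℤ + sgn e` is 0 for odd e and 2 for even e, and halving an even e turns
-- factorisations of 2n into factorisations of n.
∑-even-cofactor : ∀ n (g : ℕ → ℕ → ℤ) →
  ∑ (list (cofactorsᴱ (2 ℕ.* n))) (λ { (d , e) → (1ℤ + sgn e) * g d e })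
  ≡ ∑ (list (cofactorsᴱ n)) (λ { (d , e) → + 2 * g d (2 ℕ.* e) })
∑-even-cofactor n g = begin
  ∑ (list (cofactorsᴱ (2 ℕ.* n))) (λ { (d , e) → (1ℤ + sgn e) * g d e })
    ≡⟨ ∑-filter even? (list (cofactorsᴱ (2 ℕ.* n)))
         (λ { (d , e) _ sgn≡1 → cong (λ s → (1ℤ + s) * g d e) sgn≡1 })
         (λ { (d , e) _ sgn≢1 → vanish d e (parity e) sgn≢1 }) ⟩
  ∑ (filter even? (list (cofactorsᴱ (2 ℕ.* n)))) (λ { (d , e) → + 2 * g d e })
    ≡⟨ ∑-reindex (cofactorsᴱ n) (filterᴱ even? (cofactorsᴱ (2 ℕ.* n))) double
         (λ { (d , e) (d′ , e′) _ _ eq → cong₂ _,_ (cong proj₁ eq) (ℕ.*-cancelˡ-≡ e e′ 2 (cong proj₂ eq)) })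
         (λ { (d , e) (1≤d , 1≤e , refl) → (1≤d , ℕ.≤-trans 1≤e (ℕ.m≤n*m e 2) , lemma d e) , sgn-2* e })
         (λ { (d , e) ((1≤d , 1≤e , eq) , sgn≡1) → from d e (parity e) 1≤d 1≤e eq sgn≡1 })
         (λ { (d , e) → + 2 * g d e }) ⟨
  ∑ (list (cofactorsᴱ n)) (λ { (d , e) → + 2 * g d (2 ℕ.* e) }) ∎
  where
  even? : Decidable (λ x → sgn (proj₂ x) ≡ 1ℤ)
  even? (d , e) = sgn e ℤ.≟ 1ℤ
  double : ℕ × ℕ → ℕ × ℕ
  double (d , e) = d , 2 ℕ.* e
  lemma : ∀ d e → d ℕ.* (2 ℕ.* e) ≡ 2 ℕ.* (d ℕ.* e)
  lemma = ℕ-Solver.solve-∀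
  vanish : ∀ d e → Parity e → sgn e ≢ 1ℤ → (1ℤ + sgn e) * g d e ≡ 0ℤ
  vanish d _ (even k) ¬p = ⊥-elim (¬p (sgn-2* k))
  vanish d e (odd k)  ¬p = cong (λ s → (1ℤ + s) * g d e) (sgn-1+2* k)
  from : ∀ d e → Parity e → 1 ≤ d → 1 ≤ e → d ℕ.* e ≡ 2 ℕ.* n → sgn e ≡ 1ℤ →
         ∃ λ x → Cofactors n x × double x ≡ (d , e)
  from d _ (odd k) _ _ _ p with () ← trans (sym (sgn-1+2* k)) p
  from d _ (even ℕ.zero) _ () _ _
  from d _ (even (ℕ.suc k)) 1≤d _ eq _ =
    (d , ℕ.suc k) , (1≤d , ℕ.s≤s ℕ.z≤n , ℕ.*-cancelˡ-≡ _ _ 2 (trans (sym (lemma d (ℕ.suc k))) eq)) , refl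

∑-no-even-cofactor : ∀ n (g : ℕ → ℕ → ℤ) →
  ∑ (list (cofactorsᴱ (ℕ.suc (2 ℕ.* n)))) (λ { (d , e) → (1ℤ + sgn e) * g d e }) ≡ 0ℤ
∑-no-even-cofactor n g = ∑-0 (list (cofactorsᴱ (ℕ.suc (2 ℕ.* n)))) λ { (d , e) x∈ →
  vanish d e (parity e) (proj₂ (proj₂ (sound (cofactorsᴱ (ℕ.suc (2 ℕ.* n))) (d , e) x∈))) }
  where
  lemma : ∀ d k → d ℕ.* (2 ℕ.* k) ≡ 2 ℕ.* (d ℕ.* k)
  lemma = ℕ-Solver.solve-∀
  vanish : ∀ d e → Parity e → d ℕ.* e ≡ ℕ.suc (2 ℕ.* n) → (1ℤ + sgn e) * g d e ≡ 0ℤ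
  vanish d e (odd k)  eq = cong (λ s → (1ℤ + s) * g d e) (sgn-1+2* k)
  vanish d _ (even k) eq
    with () ← trans (sym (sgn-2* (d ℕ.* k))) (trans (cong sgn (trans (sym (lemma d k)) eq)) (sgn-1+2* n))

-- For odd n both sides vanish. For n = 2k both equal 4σ(k): an even d is twice a divisor of k,
-- whereas an even e leaves d itself running over the divisors of k.
∑-even-divisor : ∀ n →
  ∑ (list (cofactorsᴱ n)) (λ { (d , e) → (1ℤ + sgn d) * + d })
  ≡ + 2 * ∑ (list (cofactorsᴱ n)) (λ { (d , e) → (1ℤ + sgn e) * + d })
∑-even-divisor n = trans (sym (∑-swap n (λ { (d , e) → (1ℤ + sgn d) * + d }))) (by-parity n (parity n))
  where
  by-parity : ∀ n → Parity n →
    ∑ (list (cofactorsᴱ n)) (λ { (d , e) → (1ℤ + sgn e) * + e })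
    ≡ + 2 * ∑ (list (cofactorsᴱ n)) (λ { (d , e) → (1ℤ + sgn e) * + d })
  by-parity _ (odd k)  = trans (∑-no-even-cofactor k (λ d e → + e))
    (sym (cong (+ 2 *_) (∑-no-even-cofactor k (λ d e → + d))))
  by-parity _ (even k) = begin
    ∑ (list (cofactorsᴱ (2 ℕ.* k))) (λ { (d , e) → (1ℤ + sgn e) * + e })
      ≡⟨ ∑-even-cofactor k (λ d e → + e) ⟩
    ∑ (list (cofactorsᴱ k)) (λ { (d , e) → + 2 * + (2 ℕ.* e) })
      ≡⟨ ∑-swap k (λ { (d , e) → + 2 * + (2 ℕ.* d) }) ⟩
    ∑ (list (cofactorsᴱ k)) (λ { (d , e) → + 2 * + (2 ℕ.* d) })
      ≡⟨ ∑-cong (list (cofactorsᴱ k)) (λ { (d , e) _ → cong (+ 2 *_) (ℤ.pos-* 2 d) }) ⟩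
    ∑ (list (cofactorsᴱ k)) (λ { (d , e) → + 2 * (+ 2 * + d) })
      ≡⟨ ∑-*ˡ (+ 2) (list (cofactorsᴱ k)) (λ { (d , e) → + 2 * + d }) ⟩
    + 2 * ∑ (list (cofactorsᴱ k)) (λ { (d , e) → + 2 * + d })
      ≡⟨ cong (+ 2 *_) (∑-even-cofactor k (λ d e → + d)) ⟨
    + 2 * ∑ (list (cofactorsᴱ (2 ℕ.* k))) (λ { (d , e) → (1ℤ + sgn e) * + d }) ∎

+sum : ∀ xs → + sum xs ≡ ∑ xs (λ d → + d)
+sum []       = refl
+sum (x ∷ xs) = cong (λ t → + x + t) (+sum xs)

sgn-isEven : ∀ d → sgn d ≡ (if isEven d then 1ℤ else ℤ.-1ℤ)
sgn-isEven ℕ.zero            = refl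
sgn-isEven (ℕ.suc ℕ.zero)    = refl
sgn-isEven (ℕ.suc (ℕ.suc d)) = sgn-isEven d

σ-∑ : ∀ n → σ n ≡ ∑ (list (cofactorsᴱ n)) (λ { (d , e) → + d })
σ-∑ n = trans (+sum (divisors n)) (sym (∑-cofactors n _))

2σo-∑ : ∀ n → + 2 * σo n ≡ ∑ (list (cofactorsᴱ n)) (λ { (d , e) → (1ℤ - sgn d) * + d })
2σo-∑ n = begin
  + 2 * σo n                                                 ≡⟨ cong (+ 2 *_) (+sum (filter odd? (divisors n))) ⟩
  + 2 * ∑ (filter odd? (divisors n)) (λ d → + d)                      ≡⟨ ∑-*ˡ (+ 2) (filter odd? (divisors n)) (λ d → + d) ⟨
  ∑ (filter odd? (divisors n)) (λ d → + 2 * + d)             ≡⟨ ∑-filter odd? (divisors n) yes-case no-case ⟨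
  ∑ (divisors n) (λ d → (1ℤ - sgn d) * + d)                  ≡⟨ ∑-cofactors n _ ⟨
  ∑ (list (cofactorsᴱ n)) (λ { (d , e) → (1ℤ - sgn d) * + d })  ∎
  where
  odd? : Decidable (λ d → not (isEven d) ≡ true)
  odd? d = not (isEven d) Data.Bool.≟ true
  yes-case : ∀ d → d ∈ divisors n → not (isEven d) ≡ true → (1ℤ - sgn d) * + d ≡ + 2 * + d
  yes-case d _ p with isEven d | sgn-isEven d
  ... | false | eq = cong (λ s → (1ℤ - s) * + d) eq
  no-case : ∀ d → d ∈ divisors n → ¬ not (isEven d) ≡ true → (1ℤ - sgn d) * + d ≡ 0ℤ
  no-case d _ ¬p with isEven d | sgn-isEven d
  ... | true  | eq = cong (λ s → (1ℤ - s) * + d) eq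
  ... | false | eq = ⊥-elim (¬p refl)

2σe-∑ : ∀ n → + 2 * σe n ≡ ∑ (list (cofactorsᴱ n)) (λ { (d , e) → (1ℤ + sgn d) * + d })
2σe-∑ n = begin
  + 2 * σe n                                                 ≡⟨ cong (+ 2 *_) (+sum (filter even? (divisors n))) ⟩
  + 2 * ∑ (filter even? (divisors n)) (λ d → + d)                     ≡⟨ ∑-*ˡ (+ 2) (filter even? (divisors n)) (λ d → + d) ⟨
  ∑ (filter even? (divisors n)) (λ d → + 2 * + d)            ≡⟨ ∑-filter even? (divisors n) yes-case no-case ⟨
  ∑ (divisors n) (λ d → (1ℤ + sgn d) * + d)                  ≡⟨ ∑-cofactors n _ ⟨
  ∑ (list (cofactorsᴱ n)) (λ { (d , e) → (1ℤ + sgn d) * + d })  ∎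
  where
  even? : Decidable (λ d → isEven d ≡ true)
  even? d = isEven d Data.Bool.≟ true
  yes-case : ∀ d → d ∈ divisors n → isEven d ≡ true → (1ℤ + sgn d) * + d ≡ + 2 * + d
  yes-case d _ p with isEven d | sgn-isEven d
  ... | true | eq = cong (λ s → (1ℤ + s) * + d) eq
  no-case : ∀ d → d ∈ divisors n → ¬ isEven d ≡ true → (1ℤ + sgn d) * + d ≡ 0ℤ
  no-case d _ ¬p with isEven d | sgn-isEven d
  ... | false | eq = cong (λ s → (1ℤ + s) * + d) eq
  ... | true  | eq = ⊥-elim (¬p refl)

-- The parity condition moves from the divisor to its cofactor: the difference of the two sides,
-- doubled, is exactly the relation of `∑-even-divisor`. Read with d and e exchanged, the right side
-- is `σs`.
σo-∑ : ∀ n → σo n ≡ ∑ (list (cofactorsᴱ n)) (λ { (d , e) → - sgn e * + d })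
σo-∑ n = ℤ.*-cancelˡ-≡ (+ 2) _ _ (begin
  + 2 * σo n
    ≡⟨ 2σo-∑ n ⟩
  ∑ C (λ { (d , e) → (1ℤ - sgn d) * + d })
    ≡⟨ ∑-cong C (λ { (d , e) _ → l₁ (sgn d) (sgn e) (+ d) }) ⟩
  ∑ C (λ { (d , e) → + 2 * (- sgn e * + d) + (+ 2 * ((1ℤ + sgn e) * + d) + ℤ.-1ℤ * ((1ℤ + sgn d) * + d)) })
    ≡⟨ ∑-+ C (λ { (d , e) → + 2 * (- sgn e * + d) }) (λ { (d , e) → + 2 * ((1ℤ + sgn e) * + d) + ℤ.-1ℤ * ((1ℤ + sgn d) * + d) }) ⟩
  ∑ C (λ { (d , e) → + 2 * (- sgn e * + d) }) + ∑ C (λ { (d , e) → + 2 * ((1ℤ + sgn e) * + d) + ℤ.-1ℤ * ((1ℤ + sgn d) * + d) })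
    ≡⟨ cong₂ _+_ (∑-*ˡ (+ 2) C (λ { (d , e) → - sgn e * + d })) cancel ⟩
  + 2 * ∑ C (λ { (d , e) → - sgn e * + d }) + 0ℤ
    ≡⟨ ℤ.+-identityʳ _ ⟩
  + 2 * ∑ C (λ { (d , e) → - sgn e * + d }) ∎)
  where
  C = list (cofactorsᴱ n)
  l₁ : ∀ s t d → (1ℤ - s) * d ≡ + 2 * (- t * d) + (+ 2 * ((1ℤ + t) * d) + ℤ.-1ℤ * ((1ℤ + s) * d))
  l₁ = solve-∀
  l₂ : ∀ x → x + ℤ.-1ℤ * x ≡ 0ℤ
  l₂ = solve-∀
  cancel : ∑ C (λ { (d , e) → + 2 * ((1ℤ + sgn e) * + d) + ℤ.-1ℤ * ((1ℤ + sgn d) * + d) }) ≡ 0ℤ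
  cancel = begin
    ∑ C (λ { (d , e) → + 2 * ((1ℤ + sgn e) * + d) + ℤ.-1ℤ * ((1ℤ + sgn d) * + d) })
      ≡⟨ ∑-+ C (λ { (d , e) → + 2 * ((1ℤ + sgn e) * + d) }) (λ { (d , e) → ℤ.-1ℤ * ((1ℤ + sgn d) * + d) }) ⟩
    ∑ C (λ { (d , e) → + 2 * ((1ℤ + sgn e) * + d) }) + ∑ C (λ { (d , e) → ℤ.-1ℤ * ((1ℤ + sgn d) * + d) })
      ≡⟨ cong₂ _+_ (trans (∑-*ˡ (+ 2) C (λ { (d , e) → (1ℤ + sgn e) * + d })) (sym (∑-even-divisor n)))
                   (∑-*ˡ ℤ.-1ℤ C (λ { (d , e) → (1ℤ + sgn d) * + d })) ⟩
    ∑ C (λ { (d , e) → (1ℤ + sgn d) * + d }) + ℤ.-1ℤ * ∑ C (λ { (d , e) → (1ℤ + sgn d) * + d })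
      ≡⟨ l₂ (∑ C (λ { (d , e) → (1ℤ + sgn d) * + d })) ⟩
    0ℤ ∎

-- Recognises a list function from its recursion equations, as required for the summation local to
-- `σs`.
∑-unique : (F : List X → ℤ) (f : X → ℤ) → F [] ≡ 0ℤ → (∀ x xs → F (x ∷ xs) ≡ f x + F xs) →
           ∀ xs → F xs ≡ ∑ xs f
∑-unique F f nil cons []       = nil
∑-unique F f nil cons (x ∷ xs) = trans (cons x xs) (cong (λ t → f x + t) (∑-unique F f nil cons xs))

-- The summation inside σs is local to its definition and has no name outside it;
-- abstracting divisors n lets unification recover it as the value of the underscore.
mutual
  σs-sum : ℕ → List ℕ → ℤ
  σs-sum = _

  σs-unfold : ∀ n → σs n ≡ σs-sum n (divisors n)
  σs-unfold n with divisors n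
  ... | ds = refl

σs-∑-divisors : ∀ n → σs n ≡ ∑ (divisors n) (λ d → sgn (d ∸ 1) * + quotient n d)
σs-∑-divisors n = trans (σs-unfold n)
  (∑-unique (σs-sum n) _ refl (λ { ℕ.zero _ → refl ; (ℕ.suc _) _ → refl }) (divisors n))

σs-∑ : ∀ n → σs n ≡ ∑ (list (cofactorsᴱ n)) (λ { (d , e) → - sgn d * + e })
σs-∑ n = begin
  σs n                                                             ≡⟨ σs-∑-divisors n ⟩
  ∑ (divisors n) (λ d → sgn (d ∸ 1) * + quotient n d)              ≡⟨ ∑-cong (divisors n) (λ d _ → sign d) ⟩
  ∑ (divisors n) (λ d → - sgn d * + quotient n d)                  ≡⟨ ∑-cofactors n _ ⟨
  ∑ (list (cofactorsᴱ n)) (λ { (d , e) → - sgn d * + e })          ∎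
  where
  sign : ∀ d → sgn (d ∸ 1) * + quotient n d ≡ - sgn d * + quotient n d
  -- At 0 the truncated exponent breaks the sign rule, but there the quotient is 0.
  sign ℕ.zero    = refl
  sign (ℕ.suc d) = cong (_* + quotient n (ℕ.suc d))
    (trans (sym (ℤ.neg-involutive (sgn d))) (cong -_ (sym (sgn-suc d))))

σs≡σo : ∀ n → σs n ≡ σo n
σs≡σo n = trans (σs-∑ n) (trans (∑-swap n (λ { (d , e) → - sgn e * + d })) (sym (σo-∑ n)))

-- For even e both sides vanish; for odd e the numbers d and de have the same parity. The sign in
-- `twisted 0` thus depends on n alone.
sgn-*-odd : ∀ d e → sgn d * (1ℤ - sgn e) ≡ sgn (d ℕ.* e) * (1ℤ - sgn e)
sgn-*-odd d e with parity e
... | even k = trans (vanish d) (sym (vanish (d ℕ.* (2 ℕ.* k))))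
  where
  vanish : ∀ m → sgn m * (1ℤ - sgn (2 ℕ.* k)) ≡ 0ℤ
  vanish m = trans (cong (λ s → sgn m * (1ℤ - s)) (sgn-2* k)) (ℤ.*-zeroʳ (sgn m))
... | odd k = cong (_* (1ℤ - sgn (ℕ.suc (2 ℕ.* k)))) (sym (begin
  sgn (d ℕ.* ℕ.suc (2 ℕ.* k))      ≡⟨ cong sgn (lemma d k) ⟩
  sgn (d ℕ.+ 2 ℕ.* (d ℕ.* k))      ≡⟨ sgn-+ d _ ⟩
  sgn d * sgn (2 ℕ.* (d ℕ.* k))    ≡⟨ cong (sgn d *_) (sgn-2* (d ℕ.* k)) ⟩
  sgn d * 1ℤ                       ≡⟨ ℤ.*-identityʳ (sgn d) ⟩
  sgn d                            ∎))
  where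
  lemma : ∀ d k → d ℕ.* ℕ.suc (2 ℕ.* k) ≡ d ℕ.+ 2 ℕ.* (d ℕ.* k)
  lemma = ℕ-Solver.solve-∀

-- The contribution to S of one fibre, with n in the place of N - i(i+ε).
twisted : ℕ → ℕ → ℤ
twisted ε n = ∑ (list (cofactorsᴱ n)) (λ { (d , e) → sgn d * (1ℤ - sgn (ε ℕ.+ e)) * + d })

twisted-0 : ∀ n → twisted 0 n ≡ sgn n * (σ n + σo n)
twisted-0 n = begin
  twisted 0 n
    ≡⟨ ∑-cong C (λ { (d , e) x∈ → term d e (proj₂ (proj₂ (sound (cofactorsᴱ n) (d , e) x∈))) }) ⟩
  ∑ C (λ { (d , e) → sgn n * (+ d + - sgn e * + d) })
    ≡⟨ ∑-*ˡ (sgn n) C (λ { (d , e) → + d + - sgn e * + d }) ⟩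
  sgn n * ∑ C (λ { (d , e) → + d + - sgn e * + d })
    ≡⟨ cong (sgn n *_) (∑-+ C (λ { (d , e) → + d }) (λ { (d , e) → - sgn e * + d })) ⟩
  sgn n * (∑ C (λ { (d , e) → + d }) + ∑ C (λ { (d , e) → - sgn e * + d }))
    ≡⟨ cong₂ (λ s t → sgn n * (s + t)) (σ-∑ n) (σo-∑ n) ⟨
  sgn n * (σ n + σo n) ∎
  where
  C = list (cofactorsᴱ n)
  l : ∀ s t d → s * (1ℤ - t) * d ≡ s * (d + - t * d)
  l = solve-∀
  term : ∀ d e → d ℕ.* e ≡ n → sgn d * (1ℤ - sgn e) * + d ≡ sgn n * (+ d + - sgn e * + d)
  term d e refl = trans (cong (_* + d) (sgn-*-odd d e)) (l (sgn (d ℕ.* e)) (sgn e) (+ d))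

-- For ε = 1 the factor becomes 1 + (-1)^e and selects even cofactors. Halving them explains the
-- choice N = 2n and leaves 2 Σ (-1)^d d over the divisors of n.
twisted-1 : ∀ n → twisted 1 (2 ℕ.* n) ≡ - + 2 * (σo n - σe n)
twisted-1 n = begin
  twisted 1 (2 ℕ.* n)
    ≡⟨ ∑-cong (list (cofactorsᴱ (2 ℕ.* n)))
         (λ { (d , e) _ → trans (cong (λ s → sgn d * (1ℤ - s) * + d) (sgn-suc e)) (l₁ (sgn d) (sgn e) (+ d)) }) ⟩
  ∑ (list (cofactorsᴱ (2 ℕ.* n))) (λ { (d , e) → (1ℤ + sgn e) * (sgn d * + d) })
    ≡⟨ ∑-even-cofactor n (λ d e → sgn d * + d) ⟩
  ∑ C (λ { (d , e) → + 2 * (sgn d * + d) })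
    ≡⟨ ∑-cong C (λ { (d , e) _ → l₂ (sgn d) (+ d) }) ⟩
  ∑ C (λ { (d , e) → (1ℤ + sgn d) * + d + ℤ.-1ℤ * ((1ℤ - sgn d) * + d) })
    ≡⟨ ∑-+ C (λ { (d , e) → (1ℤ + sgn d) * + d }) (λ { (d , e) → ℤ.-1ℤ * ((1ℤ - sgn d) * + d) }) ⟩
  ∑ C (λ { (d , e) → (1ℤ + sgn d) * + d }) + ∑ C (λ { (d , e) → ℤ.-1ℤ * ((1ℤ - sgn d) * + d) })
    ≡⟨ cong₂ _+_ (sym (2σe-∑ n)) (trans (∑-*ˡ ℤ.-1ℤ C (λ { (d , e) → (1ℤ - sgn d) * + d })) (cong (ℤ.-1ℤ *_) (sym (2σo-∑ n)))) ⟩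
  + 2 * σe n + ℤ.-1ℤ * (+ 2 * σo n)
    ≡⟨ l₃ (σe n) (σo n) ⟩
  - + 2 * (σo n - σe n) ∎
  where
  C = list (cofactorsᴱ n)
  l₁ : ∀ s t d → s * (1ℤ - - t) * d ≡ (1ℤ + t) * (s * d)
  l₁ = solve-∀
  l₂ : ∀ s d → + 2 * (s * d) ≡ (1ℤ + s) * d + ℤ.-1ℤ * ((1ℤ - s) * d)
  l₂ = solve-∀
  l₃ : ∀ x y → + 2 * x + ℤ.-1ℤ * (+ 2 * y) ≡ - + 2 * (y - x)
  l₃ = solve-∀

-- The triples of Repr, fibred over their first coordinate

module Fibres (ε : ℕ) (ε≤1 : ε ≤ 1) (N : ℕ) where

  pronic⁻ : ∀ {ε} → ε ≤ 1 → ∀ m → ℤ.-[1+ m ] * (ℤ.-[1+ m ] + + ε) ≡ + (ℕ.suc m ℕ.* (ℕ.suc m ∸ ε))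
  pronic⁻ ℕ.z≤n           m         = refl
  pronic⁻ (ℕ.s≤s ℕ.z≤n) ℕ.zero    = refl
  pronic⁻ (ℕ.s≤s ℕ.z≤n) (ℕ.suc m) = refl

  -- This is i(i+ε) as a natural number. For i = -(m+1) it equals (m+1)(m+1-ε), where the truncated
  -- subtraction is exact because ε ≤ 1.
  height : ℤ → ℕ
  height (+ m)      = m ℕ.* (m ℕ.+ ε)
  height ℤ.-[1+ m ] = ℕ.suc m ℕ.* (ℕ.suc m ∸ ε)

  +height : ∀ i → + height i ≡ i * (i + + ε)
  +height (+ m)      = ℤ.pos-* m (m ℕ.+ ε)
  +height ℤ.-[1+ m ] = sym (pronic⁻ ε≤1 m)

  -- The window -(N+1), ..., N contains every i of height at most N. Its surplus members do no harm:
  -- their fibre consists of the factorisations of 0, of which there are none.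
  indices : List ℤ
  indices = map (λ m → + m) (upTo (ℕ.suc N)) ++ map ℤ.-[1+_] (upTo (ℕ.suc N))

  indicesᴱ : Enumeration (_∈ indices)
  indicesᴱ = record
    { list     = indices
    ; unique   = Unique.++⁺ (Unique.map⁺ ℤ.+-injective (Unique.upTo⁺ _)) (Unique.map⁺ ℤ.-[1+-injective (Unique.upTo⁺ _)) disjoint
    ; sound    = λ _ i∈ → i∈
    ; complete = λ _ i∈ → i∈
    }
    where
    disjoint : ∀ {i} → ¬ (i ∈ map (λ m → + m) (upTo (ℕ.suc N)) × i ∈ map ℤ.-[1+_] (upTo (ℕ.suc N)))
    disjoint (p , q) with ∈-map⁻ _ p | ∈-map⁻ _ q
    ... | _ , _ , refl | _ , _ , ()

  m≤height : ∀ m → m ≤ height (+ m)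
  m≤height ℕ.zero    = ℕ.z≤n
  m≤height (ℕ.suc m) = ℕ.m≤m*n (ℕ.suc m) (ℕ.suc m ℕ.+ ε)

  m≤height⁻ : ∀ {ε} → ε ≤ 1 → ∀ m → m ≤ ℕ.suc m ℕ.* (ℕ.suc m ∸ ε)
  m≤height⁻ ℕ.z≤n           m = ℕ.≤-trans (ℕ.n≤1+n m) (ℕ.m≤m*n (ℕ.suc m) (ℕ.suc m))
  m≤height⁻ (ℕ.s≤s ℕ.z≤n) m = ℕ.m≤m+n m (m ℕ.* m)

  height≤N⇒∈ : ∀ i → height i ≤ N → i ∈ indices
  height≤N⇒∈ (+ m)      h = ∈-++⁺ˡ (∈-map⁺ (λ m → + m) (∈-upTo⁺ (ℕ.s≤s (ℕ.≤-trans (m≤height m) h))))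
  height≤N⇒∈ ℤ.-[1+ m ] h = ∈-++⁺ʳ (map (λ m → + m) (upTo (ℕ.suc N))) (∈-map⁺ ℤ.-[1+_] (∈-upTo⁺ (ℕ.s≤s (ℕ.≤-trans (m≤height⁻ ε≤1 m) h))))

  fibredᴱ : Enumeration {ℤ × (ℕ × ℕ)} (λ { (i , x) → i ∈ indices × Cofactors (N ∸ height i) x })
  fibredᴱ = sigmaᴱ indicesᴱ (λ i → cofactorsᴱ (N ∸ height i))

  embed : ℤ × (ℕ × ℕ) → ℤ × ℤ × ℤ
  embed (i , d , e) = i , + d , + e

  reprᴱ : Enumeration (Repr (+ ε) (+ N))
  reprᴱ = mapᴱ fibredᴱ embed (λ _ _ _ _ → embed-injective) to from
    where
    embed-injective : ∀ {x y} → embed x ≡ embed y → x ≡ y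
    embed-injective refl = refl
    eqn : ∀ i d e → i * (i + + ε) + + d * + e ≡ + (height i ℕ.+ d ℕ.* e)
    eqn i d e = sym (cong₂ _+_ (+height i) (ℤ.pos-* d e))
    to : ∀ x → proj₁ x ∈ indices × Cofactors (N ∸ height (proj₁ x)) (proj₂ x) → Repr (+ ε) (+ N) (embed x)
    to (i , d , e) (_ , 1≤d , 1≤e , de≡) = repr (ℤ.+<+ 1≤d) (ℤ.+<+ 1≤e) (trans (eqn i d e) (cong (λ k → + k)
      (trans (cong (height i ℕ.+_) de≡) (ℕ.m+[n∸m]≡n {height i} {N} (ℕ.<⇒≤ (ℕ.m∸n≢0⇒n<m {N} {height i} N∸h≢0))))))
      where
      -- A factorisation has product at least 1, which certifies that the subtraction was not
      -- truncated.
      N∸h≢0 : N ∸ height i ≢ 0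
      N∸h≢0 eq with () ← ℕ.≤-trans (ℕ.*-mono-≤ 1≤d 1≤e) (ℕ.≤-reflexive (trans de≡ eq))
    from : ∀ x → Repr (+ ε) (+ N) x →
           ∃ λ y → (proj₁ y ∈ indices × Cofactors (N ∸ height (proj₁ y)) (proj₂ y)) × embed y ≡ x
    from (i , d , e) (repr d>0 e>0 eq) with positive d>0 | positive e>0
    ... | a , refl | b , refl = (i , ℕ.suc a , ℕ.suc b)
      , (height≤N⇒∈ i (ℕ.≤-trans (ℕ.m≤m+n (height i) _) (ℕ.≤-reflexive total))
        , ℕ.s≤s ℕ.z≤n , ℕ.s≤s ℕ.z≤n
        , trans (sym (ℕ.m+n∸m≡n (height i) _)) (cong (_∸ height i) total))
      , refl
      where
      total : height i ℕ.+ ℕ.suc a ℕ.* ℕ.suc b ≡ N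
      total = ℤ.+-injective (trans (sym (eqn i (ℕ.suc a) (ℕ.suc b))) eq)

  open Descent (+ ε) (+ N) reprᴱ using (weight)

  ∑-fibres : ∑ (list reprᴱ) (λ x → weight x * proj₁ (proj₂ x))
    ≡ ∑ (upTo (ℕ.suc N)) (λ m → twisted ε (N ∸ m ℕ.* (m ℕ.+ ε)))
    + ∑ (upTo (ℕ.suc N)) (λ m → twisted ε (N ∸ ℕ.suc m ℕ.* (ℕ.suc m ∸ ε)))
  ∑-fibres = begin
    ∑ (list reprᴱ) f
      ≡⟨ ∑-map embed (list fibredᴱ) f ⟩
    ∑ (list fibredᴱ) (f ∘ embed)
      ≡⟨ ∑-sigma indicesᴱ (λ i → cofactorsᴱ (N ∸ height i)) (f ∘ embed) ⟩
    ∑ indices h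
      ≡⟨ ∑-++ (map (λ m → + m) (upTo (ℕ.suc N))) _ h ⟩
    ∑ (map (λ m → + m) (upTo (ℕ.suc N))) h + ∑ (map ℤ.-[1+_] (upTo (ℕ.suc N))) h
      ≡⟨ cong₂ _+_ (∑-map (λ m → + m) (upTo (ℕ.suc N)) h) (∑-map ℤ.-[1+_] (upTo (ℕ.suc N)) h) ⟩
    ∑ (upTo (ℕ.suc N)) (λ m → twisted ε (N ∸ m ℕ.* (m ℕ.+ ε)))
      + ∑ (upTo (ℕ.suc N)) (λ m → twisted ε (N ∸ ℕ.suc m ℕ.* (ℕ.suc m ∸ ε))) ∎
    where
    f : ℤ × ℤ × ℤ → ℤ
    f x = weight x * proj₁ (proj₂ x)
    h : ℤ → ℤ
    h i = twisted ε (N ∸ height i)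

-- Indicators

-- The common shape of `δs` and `δt`, which are instances of it by definition.
indicator : {P : ℕ → Set} → Decidable P → ℕ → ℤ
indicator P? n = if any (λ m → ⌊ P? m ⌋) (upTo (ℕ.suc n)) then + 1 else + 0

indicator-dichotomy : {P : ℕ → Set} (P? : Decidable P) (n : ℕ) → (∀ m → P m → m ≤ n) →
  (indicator P? n ≡ 1ℤ × ∃ P) ⊎ (indicator P? n ≡ 0ℤ × (∀ m → ¬ P m))
indicator-dichotomy P? n bound with any (λ m → ⌊ P? m ⌋) (upTo (ℕ.suc n)) in eq
... | true  = let m , _ , t = find (any⁻ (λ m → ⌊ P? m ⌋) (upTo (ℕ.suc n)) (subst T (sym eq) _))
              in inj₁ (refl , m , toWitness {a? = P? m} t)
... | false = inj₂ (refl , λ m pm → subst T eq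
                (any⁺ (λ m → ⌊ P? m ⌋) (lose (∈-upTo⁺ (ℕ.s≤s (bound m pm))) (fromWitness {a? = P? m} pm))))

module Image (q : ℕ → ℕ) (q-injective : ∀ j k → q j ≡ q k → j ≡ k) (m≤q : ∀ m → m ≤ q m) (δ : ℕ → ℤ)
             (δ-dichotomy : ∀ n → (δ n ≡ 1ℤ × ∃ λ m → q m ≡ n) ⊎ (δ n ≡ 0ℤ × (∀ m → q m ≢ n))) where

  -- Where q m exceeds n, truncation gives f 0 = 0. Each k ≤ n with δ k = 1 comes from exactly one
  -- m, and m ≤ q m = k ≤ n ≤ L places it in the range.
  ∑-image : ∀ n L → n ≤ L → (f : ℕ → ℤ) → f 0 ≡ 0ℤ →
            ∑ (upTo (ℕ.suc L)) (λ m → f (n ∸ q m)) ≡ ∑ (upTo (ℕ.suc n)) (λ k → δ k * f (n ∸ k))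
  ∑-image n L n≤L f f0 = begin
    ∑ (upTo (ℕ.suc L)) (λ m → f (n ∸ q m))
      ≡⟨ ∑-filter (λ m → q m ℕ.≤? n) (upTo (ℕ.suc L)) (λ _ _ _ → refl)
           (λ m _ q≰n → trans (cong f (ℕ.m≤n⇒m∸n≡0 (ℕ.<⇒≤ (ℕ.≰⇒> q≰n)))) f0) ⟩
    ∑ (filter (λ m → q m ℕ.≤? n) (upTo (ℕ.suc L))) (λ m → f (n ∸ q m))
      ≡⟨ ∑-reindex (filterᴱ (λ m → q m ℕ.≤? n) (upToᴱ (ℕ.suc L))) (filterᴱ (λ k → δ k ℤ.≟ 1ℤ) (upToᴱ (ℕ.suc n))) q
           (λ j k _ _ → q-injective j k)
           (λ m (_ , q≤n) → ℕ.s≤s q≤n , δ-image m)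
           (λ k (k≤n , δ≡1) → preimage k (ℕ.s≤s⁻¹ k≤n) δ≡1 (δ-dichotomy k)) (λ k → f (n ∸ k)) ⟩
    ∑ (filter (λ k → δ k ℤ.≟ 1ℤ) (upTo (ℕ.suc n))) (λ k → f (n ∸ k))
      ≡⟨ ∑-filter (λ k → δ k ℤ.≟ 1ℤ) (upTo (ℕ.suc n))
           (λ k _ δ≡1 → trans (cong (_* f (n ∸ k)) δ≡1) (ℤ.*-identityˡ (f (n ∸ k))))
           (λ k _ δ≢1 → vanish k δ≢1 (δ-dichotomy k)) ⟨
    ∑ (upTo (ℕ.suc n)) (λ k → δ k * f (n ∸ k)) ∎
    where
    δ-image : ∀ m → δ (q m) ≡ 1ℤ
    δ-image m with δ-dichotomy (q m)
    ... | inj₁ (δ≡1 , _) = δ≡1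
    ... | inj₂ (_ , h)   = ⊥-elim (h m refl)
    preimage : ∀ k → k ≤ n → δ k ≡ 1ℤ → (δ k ≡ 1ℤ × ∃ λ m → q m ≡ k) ⊎ (δ k ≡ 0ℤ × (∀ m → q m ≢ k)) →
               ∃ λ m → (m ℕ.< ℕ.suc L × q m ≤ n) × q m ≡ k
    preimage _ k≤n _ (inj₁ (_ , m , refl)) = m , (ℕ.s≤s (ℕ.≤-trans (m≤q m) (ℕ.≤-trans k≤n n≤L)) , k≤n) , refl
    preimage k _ δ≡1 (inj₂ (δ≡0 , _)) with () ← trans (sym δ≡1) δ≡0
    vanish : ∀ k → δ k ≢ 1ℤ → (δ k ≡ 1ℤ × ∃ λ m → q m ≡ k) ⊎ (δ k ≡ 0ℤ × (∀ m → q m ≢ k)) → δ k * f (n ∸ k) ≡ 0ℤ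
    vanish k δ≢1 (inj₁ (δ≡1 , _)) = ⊥-elim (δ≢1 δ≡1)
    vanish k _   (inj₂ (δ≡0 , _)) = cong (_* f (n ∸ k)) δ≡0

sumFrom1-cong : ∀ n {f g : ℕ → ℤ} → (∀ k → k ≤ n → f k ≡ g k) → sumFrom1 n f ≡ sumFrom1 n g
sumFrom1-cong ℕ.zero    h = refl
sumFrom1-cong (ℕ.suc n) h = cong₂ _+_ (sumFrom1-cong n (λ k k≤n → h k (ℕ.m≤n⇒m≤1+n k≤n))) (h (ℕ.suc n) ℕ.≤-refl)

sumFrom1-*ˡ : ∀ n c f → sumFrom1 n (λ k → c * f k) ≡ c * sumFrom1 n f
sumFrom1-*ˡ n c f = begin
  sumFrom1 n (λ k → c * f k)                    ≡⟨ ∑-suc-upTo n _ ⟨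
  ∑ (map ℕ.suc (upTo n)) (λ k → c * f k)        ≡⟨ ∑-*ˡ c (map ℕ.suc (upTo n)) f ⟩
  c * ∑ (map ℕ.suc (upTo n)) f                  ≡⟨ cong (c *_) (∑-suc-upTo n f) ⟩
  c * sumFrom1 n f                              ∎

∑-upTo-suc : ∀ n f → ∑ (upTo n) (f ∘ ℕ.suc) ≡ sumFrom1 n f
∑-upTo-suc n f = trans (sym (∑-map ℕ.suc (upTo n) f)) (∑-suc-upTo n f)

∑-reverse : ∀ n (f : ℕ → ℤ) → ∑ (upTo (ℕ.suc n)) (λ k → f (n ∸ k)) ≡ ∑ (upTo (ℕ.suc n)) f
∑-reverse n f = ∑-reindex (upToᴱ (ℕ.suc n)) (upToᴱ (ℕ.suc n)) (n ∸_)
  (λ j k j≤n k≤n → ℕ.∸-cancelˡ-≡ (ℕ.s≤s⁻¹ j≤n) (ℕ.s≤s⁻¹ k≤n))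
  (λ k _ → ℕ.s≤s (ℕ.m∸n≤m n k))
  (λ k k≤n → n ∸ k , ℕ.s≤s (ℕ.m∸n≤m n k) , ℕ.m∸[m∸n]≡n (ℕ.s≤s⁻¹ k≤n)) f

-- Squares and triangular numbers

-- The summand 0 reproduces the shape m(m+ε) of `height` at ε = 0.
square : ℕ → ℕ
square m = m ℕ.* (m ℕ.+ 0)

m≤square : ∀ m → m ≤ square m
m≤square ℕ.zero    = ℕ.z≤n
m≤square (ℕ.suc m) = ℕ.m≤m*n (ℕ.suc m) (ℕ.suc m ℕ.+ 0)

m*m≡square : ∀ m → m ℕ.* m ≡ square m
m*m≡square m = cong (m ℕ.*_) (sym (ℕ.+-identityʳ m))

δs-dichotomy : ∀ n → (δs n ≡ 1ℤ × ∃ λ m → square m ≡ n) ⊎ (δs n ≡ 0ℤ × (∀ m → square m ≢ n))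
δs-dichotomy n with indicator-dichotomy (λ m → m ℕ.* m ℕ.≟ n) n
                      (λ m m²≡n → ℕ.≤-trans (m≤square m) (ℕ.≤-reflexive (trans (sym (m*m≡square m)) m²≡n)))
... | inj₁ (δ≡1 , m , eq) = inj₁ (δ≡1 , m , trans (sym (m*m≡square m)) eq)
... | inj₂ (δ≡0 , h)      = inj₂ (δ≡0 , λ m eq → h m (trans (m*m≡square m) eq))

triangle : ℕ → ℕ
triangle ℕ.zero    = 0
triangle (ℕ.suc m) = ℕ.suc m ℕ.+ triangle m

2*triangle : ∀ m → 2 ℕ.* triangle m ≡ m ℕ.* (m ℕ.+ 1)
2*triangle ℕ.zero    = refl
2*triangle (ℕ.suc m) = begin
  2 ℕ.* (ℕ.suc m ℕ.+ triangle m)          ≡⟨ ℕ.*-distribˡ-+ 2 (ℕ.suc m) (triangle m) ⟩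
  2 ℕ.* ℕ.suc m ℕ.+ 2 ℕ.* triangle m      ≡⟨ cong (2 ℕ.* ℕ.suc m ℕ.+_) (2*triangle m) ⟩
  2 ℕ.* ℕ.suc m ℕ.+ m ℕ.* (m ℕ.+ 1)       ≡⟨ lemma m ⟩
  ℕ.suc m ℕ.* (ℕ.suc m ℕ.+ 1)             ∎
  where
  lemma : ∀ m → 2 ℕ.* ℕ.suc m ℕ.+ m ℕ.* (m ℕ.+ 1) ≡ ℕ.suc m ℕ.* (ℕ.suc m ℕ.+ 1)
  lemma = ℕ-Solver.solve-∀

m≤triangle : ∀ m → m ≤ triangle m
m≤triangle ℕ.zero    = ℕ.z≤n
m≤triangle (ℕ.suc m) = ℕ.m≤m+n (ℕ.suc m) (triangle m)

triangle-injective : ∀ j k → triangle j ≡ triangle k → j ≡ k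
triangle-injective j k eq = pronic-injective 1 j k
  (trans (sym (2*triangle j)) (trans (cong (2 ℕ.*_) eq) (2*triangle k)))

triangle≡ : ∀ m n → m ℕ.* ℕ.suc m ≡ 2 ℕ.* n → triangle m ≡ n
triangle≡ m n eq = ℕ.*-cancelˡ-≡ _ _ 2 (trans (2*triangle m) (trans (cong (m ℕ.*_) (ℕ.+-comm m 1)) eq))

δt-dichotomy : ∀ n → (δt n ≡ 1ℤ × ∃ λ m → triangle m ≡ n) ⊎ (δt n ≡ 0ℤ × (∀ m → triangle m ≢ n))
δt-dichotomy n with indicator-dichotomy (λ m → m ℕ.* ℕ.suc m ℕ.≟ 2 ℕ.* n) n
                      (λ m eq → ℕ.≤-trans (m≤triangle m) (ℕ.≤-reflexive (triangle≡ m n eq)))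
... | inj₁ (δ≡1 , m , eq) = inj₁ (δ≡1 , m , triangle≡ m n eq)
... | inj₂ (δ≡0 , h)      = inj₂ (δ≡0 , λ m eq →
      h m (trans (cong (m ℕ.*_) (ℕ.+-comm 1 m)) (trans (sym (2*triangle m)) (cong (2 ℕ.*_) eq))))

-- The two convolutions of `twisted`

square-convolution : ∀ n → 1 ≤ n →
  twisted 0 n + + 2 * sumFrom1 n (λ k → δs k * twisted 0 (n ∸ k)) ≡ - + 2 * + n * δs n
square-convolution n 1≤n = begin
  g 0 + + 2 * sumFrom1 n (λ k → δs k * f (n ∸ k))
    ≡⟨ cong (λ t → g 0 + + 2 * t) image ⟨
  g 0 + + 2 * sumFrom1 n g
    ≡⟨ l (g 0) (sumFrom1 n g) ⟩
  -- The negative indices reach -(n+1), one step beyond the positive ones. The padding 0 stands for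
  -- that extra term, which vanishes because (n+1)² exceeds n.
  (g 0 + sumFrom1 n g) + (sumFrom1 n g + 0ℤ)
    ≡⟨ cong₂ _+_ (sym (∑-upTo n g)) (cong (λ t → sumFrom1 n g + t) (sym g[1+n]≡0)) ⟩
  ∑ (upTo (ℕ.suc n)) g + sumFrom1 (ℕ.suc n) g
    ≡⟨ cong (λ t → ∑ (upTo (ℕ.suc n)) g + t) (∑-upTo-suc (ℕ.suc n) g) ⟨
  ∑ (upTo (ℕ.suc n)) g + ∑ (upTo (ℕ.suc n)) (g ∘ ℕ.suc)
    ≡⟨ cong (λ t → ∑ (upTo (ℕ.suc n)) g + t)
         (∑-cong (upTo (ℕ.suc n)) (λ m _ → cong (λ k → f (n ∸ k)) (sym (m*m≡square (ℕ.suc m))))) ⟩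
  ∑ (upTo (ℕ.suc n)) g + ∑ (upTo (ℕ.suc n)) (λ m → f (n ∸ ℕ.suc m ℕ.* ℕ.suc m))
    ≡⟨ Fibres.∑-fibres 0 ℕ.z≤n n ⟨
  S
    ≡⟨ value (δs-dichotomy n) ⟩
  - + 2 * + n * δs n ∎
  where
  f g : ℕ → ℤ
  f = twisted 0
  g m = f (n ∸ square m)
  open Fibres 0 ℕ.z≤n n using (reprᴱ)
  open Descent (+ 0) (+ n) reprᴱ using (weight)
  S : ℤ
  S = ∑ (list reprᴱ) (λ x → weight x * proj₁ (proj₂ x))
  l : ∀ a b → a + + 2 * b ≡ a + b + (b + 0ℤ)
  l = solve-∀
  g[1+n]≡0 : g (ℕ.suc n) ≡ 0ℤ
  g[1+n]≡0 = cong f (ℕ.m≤n⇒m∸n≡0 (ℕ.≤-trans (ℕ.n≤1+n n) (m≤square (ℕ.suc n))))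
  image : sumFrom1 n g ≡ sumFrom1 n (λ k → δs k * f (n ∸ k))
  image = ∙-cancelˡ (g 0) _ _ (begin
    g 0 + sumFrom1 n g
      ≡⟨ ∑-upTo n g ⟨
    ∑ (upTo (ℕ.suc n)) g
      ≡⟨ Image.∑-image square (pronic-injective 0) m≤square δs δs-dichotomy n n ℕ.≤-refl f refl ⟩
    ∑ (upTo (ℕ.suc n)) (λ k → δs k * f (n ∸ k))
      ≡⟨ ∑-upTo n (λ k → δs k * f (n ∸ k)) ⟩
    1ℤ * g 0 + sumFrom1 n (λ k → δs k * f (n ∸ k))
      ≡⟨ cong (_+ sumFrom1 n (λ k → δs k * f (n ∸ k))) (ℤ.*-identityˡ (g 0)) ⟩
    g 0 + sumFrom1 n (λ k → δs k * f (n ∸ k)) ∎)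
  value : (δs n ≡ 1ℤ × ∃ λ m → square m ≡ n) ⊎ (δs n ≡ 0ℤ × (∀ m → square m ≢ n)) → S ≡ - + 2 * + n * δs n
  -- The root 0 would force n = 0; a positive root makes 2r a successor, as the boundary
  -- parametrisation requires.
  value (inj₁ (_ , ℕ.zero , eq)) with () ← ℕ.≤-trans 1≤n (ℕ.≤-reflexive (sym eq))
  value (inj₁ (δ≡1 , ℕ.suc r , eq)) = trans
    (Boundary.∑-pronic 0 ℕ.z≤n n reprᴱ (ℕ.suc r) (r ℕ.+ ℕ.suc r ℕ.+ 0) (sym eq) refl)
    (sym (trans (cong (- + 2 * + n *_) δ≡1) (ℤ.*-identityʳ _)))
  value (inj₂ (δ≡0 , h)) = trans
    (Boundary.∑-nonpronic 0 ℕ.z≤n n reprᴱ (λ k eq → h k (sym eq)))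
    (sym (trans (cong (- + 2 * + n *_) δ≡0) (ℤ.*-zeroʳ (- + 2 * + n))))

-- The indices m and -1 - m share the height m(m+1) = 2 `triangle m`, so each triangular number
-- occurs twice. The sum over m runs to 2n because that is the index range of the fibres at N = 2n.
triangle-convolution : ∀ n →
  + 2 * ∑ (upTo (ℕ.suc n)) (λ k → δt k * twisted 1 (2 ℕ.* (n ∸ k))) ≡ - + 2 * + (2 ℕ.* n) * δt n
triangle-convolution n = begin
  + 2 * ∑ (upTo (ℕ.suc n)) (λ k → δt k * f (n ∸ k))
    ≡⟨ cong (+ 2 *_) (Image.∑-image triangle triangle-injective m≤triangle δt δt-dichotomy n (2 ℕ.* n) (ℕ.m≤m+n n _) f refl) ⟨
  + 2 * ∑ (upTo (ℕ.suc (2 ℕ.* n))) (λ m → f (n ∸ triangle m))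
    ≡⟨ l (∑ (upTo (ℕ.suc (2 ℕ.* n))) (λ m → f (n ∸ triangle m))) ⟩
  ∑ (upTo (ℕ.suc (2 ℕ.* n))) (λ m → f (n ∸ triangle m)) + ∑ (upTo (ℕ.suc (2 ℕ.* n))) (λ m → f (n ∸ triangle m))
    ≡⟨ cong₂ _+_
         (∑-cong (upTo (ℕ.suc (2 ℕ.* n))) (λ m _ → cong (twisted 1) (double m)))
         (∑-cong (upTo (ℕ.suc (2 ℕ.* n))) (λ m _ → cong (twisted 1) (trans (double m) (cong (2 ℕ.* n ∸_) (flip m))))) ⟩
  ∑ (upTo (ℕ.suc (2 ℕ.* n))) (λ m → twisted 1 (2 ℕ.* n ∸ m ℕ.* (m ℕ.+ 1)))
    + ∑ (upTo (ℕ.suc (2 ℕ.* n))) (λ m → twisted 1 (2 ℕ.* n ∸ ℕ.suc m ℕ.* m))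
    ≡⟨ Fibres.∑-fibres 1 (ℕ.s≤s ℕ.z≤n) (2 ℕ.* n) ⟨
  S
    ≡⟨ value (δt-dichotomy n) ⟩
  - + 2 * + (2 ℕ.* n) * δt n ∎
  where
  f : ℕ → ℤ
  f k = twisted 1 (2 ℕ.* k)
  open Fibres 1 (ℕ.s≤s ℕ.z≤n) (2 ℕ.* n) using (reprᴱ)
  open Descent (+ 1) (+ (2 ℕ.* n)) reprᴱ using (weight)
  S : ℤ
  S = ∑ (list reprᴱ) (λ x → weight x * proj₁ (proj₂ x))
  l : ∀ a → + 2 * a ≡ a + a
  l = solve-∀
  double : ∀ m → 2 ℕ.* (n ∸ triangle m) ≡ 2 ℕ.* n ∸ m ℕ.* (m ℕ.+ 1)
  double m = trans (ℕ.*-distribˡ-∸ 2 n (triangle m)) (cong (2 ℕ.* n ∸_) (2*triangle m))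
  flip : ∀ m → m ℕ.* (m ℕ.+ 1) ≡ ℕ.suc m ℕ.* m
  flip = ℕ-Solver.solve-∀
  value : (δt n ≡ 1ℤ × ∃ λ m → triangle m ≡ n) ⊎ (δt n ≡ 0ℤ × (∀ m → triangle m ≢ n)) →
          S ≡ - + 2 * + (2 ℕ.* n) * δt n
  value (inj₁ (δ≡1 , r , eq)) = trans
    (Boundary.∑-pronic 1 (ℕ.s≤s ℕ.z≤n) (2 ℕ.* n) reprᴱ r (r ℕ.+ r)
      (trans (cong (2 ℕ.*_) (sym eq)) (2*triangle r)) (ℕ.+-comm (r ℕ.+ r) 1))
    (sym (trans (cong (- + 2 * + (2 ℕ.* n) *_) δ≡1) (ℤ.*-identityʳ _)))
  value (inj₂ (δ≡0 , h)) = trans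
    (Boundary.∑-nonpronic 1 (ℕ.s≤s ℕ.z≤n) (2 ℕ.* n) reprᴱ
      (λ k eq → h k (ℕ.*-cancelˡ-≡ _ _ 2 (trans (2*triangle k) (sym eq)))))
    (sym (trans (cong (- + 2 * + (2 ℕ.* n) *_) δ≡0) (ℤ.*-zeroʳ (- + 2 * + (2 ℕ.* n)))))

-- The three divisor-sum identities

-- Passing from `σ` + `σo` to `twisted 0` costs (-1)^(n-k), which joins (-1)^k to the common factor
-- (-1)^n.
σ+σo-convolution : (n : ℕ) → 1 ≤ n →
  σ n + σo n + (+ 2) * sumFrom1 n (λ k → sgn k * δs k * (σ (n ∸ k) + σo (n ∸ k)))
    ≡ (+ 2) * sgn (n ℕ.+ 1) * (+ n) * δs n
σ+σo-convolution n 1≤n = begin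
  w n + + 2 * sumFrom1 n (λ k → sgn k * δs k * w (n ∸ k))
    ≡⟨ cong₂ (λ a b → a + + 2 * b) (untwist n) (trans (sumFrom1-cong n term) (sumFrom1-*ˡ n (sgn n) _)) ⟩
  sgn n * twisted 0 n + + 2 * (sgn n * Z)
    ≡⟨ l₁ (sgn n) (twisted 0 n) Z ⟩
  sgn n * (twisted 0 n + + 2 * Z)
    ≡⟨ cong (sgn n *_) (square-convolution n 1≤n) ⟩
  sgn n * (- + 2 * + n * δs n)
    ≡⟨ l₂ (sgn n) (+ n) (δs n) ⟩
  + 2 * (sgn n * ℤ.-1ℤ) * + n * δs n
    ≡⟨ cong (λ s → + 2 * s * + n * δs n) (sgn-+ n 1) ⟨
  + 2 * sgn (n ℕ.+ 1) * + n * δs n ∎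
  where
  w : ℕ → ℤ
  w m = σ m + σo m
  Z : ℤ
  Z = sumFrom1 n (λ k → δs k * twisted 0 (n ∸ k))
  l₀ : ∀ s w → s * (s * w) ≡ s * s * w
  l₀ = solve-∀
  l₁ : ∀ s t z → s * t + + 2 * (s * z) ≡ s * (t + + 2 * z)
  l₁ = solve-∀
  l₂ : ∀ s n δ → s * (- + 2 * n * δ) ≡ + 2 * (s * ℤ.-1ℤ) * n * δ
  l₂ = solve-∀
  l₃ : ∀ s t δ x → s * δ * (t * x) ≡ s * t * (δ * x)
  l₃ = solve-∀
  untwist : ∀ m → w m ≡ sgn m * twisted 0 m
  untwist m = sym (begin
    sgn m * twisted 0 m      ≡⟨ cong (sgn m *_) (twisted-0 m) ⟩
    sgn m * (sgn m * w m)    ≡⟨ l₀ (sgn m) (w m) ⟩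
    sgn m * sgn m * w m      ≡⟨ cong (_* w m) (sgn-square m) ⟩
    1ℤ * w m                 ≡⟨ ℤ.*-identityˡ (w m) ⟩
    w m                      ∎)
  term : ∀ k → k ≤ n → sgn k * δs k * w (n ∸ k) ≡ sgn n * (δs k * twisted 0 (n ∸ k))
  term k k≤n = begin
    sgn k * δs k * w (n ∸ k)                             ≡⟨ cong (sgn k * δs k *_) (untwist (n ∸ k)) ⟩
    sgn k * δs k * (sgn (n ∸ k) * twisted 0 (n ∸ k))     ≡⟨ l₃ (sgn k) (sgn (n ∸ k)) (δs k) (twisted 0 (n ∸ k)) ⟩
    sgn k * sgn (n ∸ k) * (δs k * twisted 0 (n ∸ k))     ≡⟨ cong (_* (δs k * twisted 0 (n ∸ k))) (sgn-+ k (n ∸ k)) ⟨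
    sgn (k ℕ.+ (n ∸ k)) * (δs k * twisted 0 (n ∸ k))     ≡⟨ cong (λ m → sgn m * (δs k * twisted 0 (n ∸ k))) (ℕ.m+[n∸m]≡n k≤n) ⟩
    sgn n * (δs k * twisted 0 (n ∸ k))                   ∎

σo-σe-convolution : (n : ℕ) → sumFrom1 n (λ k → (σo k - σe k) * δt (n ∸ k)) ≡ (+ n) * δt n
σo-σe-convolution n = ℤ.*-cancelˡ-≡ (- + 4) _ _ (begin
  -- The constant -4 is the -2 of `twisted-1` times the 2 of the double count in
  -- `triangle-convolution`.
  - + 4 * U
    ≡⟨ l₁ U ⟩
  + 2 * (- + 2 * U)
    ≡⟨ cong (+ 2 *_) (sumFrom1-*ˡ n (- + 2) _) ⟨
  + 2 * sumFrom1 n (λ k → - + 2 * (u k * δt (n ∸ k)))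
    ≡⟨ cong (+ 2 *_) (sumFrom1-cong n (λ k k≤n → term k k≤n)) ⟩
  + 2 * sumFrom1 n (λ k → h (n ∸ k))
    ≡⟨ cong (+ 2 *_) (trans (∑-upTo n (λ k → h (n ∸ k))) (trans (cong (_+ sumFrom1 n (λ k → h (n ∸ k))) h[n]≡0) (ℤ.+-identityˡ _))) ⟨
  -- The index k = 0 may be added, since its term contains `twisted 1` at 0.
  + 2 * ∑ (upTo (ℕ.suc n)) (λ k → h (n ∸ k))
    ≡⟨ cong (+ 2 *_) (∑-reverse n h) ⟩
  + 2 * ∑ (upTo (ℕ.suc n)) h
    ≡⟨ triangle-convolution n ⟩
  - + 2 * + (2 ℕ.* n) * δt n
    ≡⟨ cong (λ t → - + 2 * t * δt n) (ℤ.pos-* 2 n) ⟩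
  - + 2 * (+ 2 * + n) * δt n
    ≡⟨ l₂ (+ n) (δt n) ⟩
  - + 4 * (+ n * δt n) ∎)
  where
  u h : ℕ → ℤ
  u k = σo k - σe k
  h k = δt k * twisted 1 (2 ℕ.* (n ∸ k))
  U : ℤ
  U = sumFrom1 n (λ k → u k * δt (n ∸ k))
  l₁ : ∀ u → - + 4 * u ≡ + 2 * (- + 2 * u)
  l₁ = solve-∀
  l₂ : ∀ n δ → - + 2 * (+ 2 * n) * δ ≡ - + 4 * (n * δ)
  l₂ = solve-∀
  l₃ : ∀ u δ → - + 2 * (u * δ) ≡ δ * (- + 2 * u)
  l₃ = solve-∀
  h[n]≡0 : h n ≡ 0ℤ
  h[n]≡0 = trans (cong (λ m → δt n * twisted 1 (2 ℕ.* m)) (ℕ.n∸n≡0 n)) (ℤ.*-zeroʳ (δt n))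
  term : ∀ k → k ≤ n → - + 2 * (u k * δt (n ∸ k)) ≡ h (n ∸ k)
  term k k≤n = begin
    - + 2 * (u k * δt (n ∸ k))            ≡⟨ l₃ (u k) (δt (n ∸ k)) ⟩
    δt (n ∸ k) * (- + 2 * u k)            ≡⟨ cong (δt (n ∸ k) *_) (twisted-1 k) ⟨
    δt (n ∸ k) * twisted 1 (2 ℕ.* k)      ≡⟨ cong (λ m → δt (n ∸ k) * twisted 1 (2 ℕ.* m)) (ℕ.m∸[m∸n]≡n k≤n) ⟨
    h (n ∸ k)                             ∎

σ+σs-convolution : (n : ℕ) → 1 ≤ n →
  σ n + σs n + (+ 2) * sumFrom1 n (λ k → sgn k * δs k * (σ (n ∸ k) + σs (n ∸ k)))
    ≡ (+ 2) * sgn (n ℕ.+ 1) * (+ n) * δs n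
σ+σs-convolution n 1≤n = trans
  (cong₂ (λ a b → σ n + a + + 2 * b) (σs≡σo n)
    (sumFrom1-cong n (λ k _ → cong (λ t → sgn k * δs k * (σ (n ∸ k) + t)) (σs≡σo (n ∸ k)))))
  (σ+σo-convolution n 1≤n)

theorem5 : ((n : ℕ) → 1 ≤ n →
    σ n + σo n + (+ 2) * sumFrom1 n (λ k → sgn k * δs k * (σ (n ∸ k) + σo (n ∸ k)))
    ≡ (+ 2) * sgn (Data.Nat._+_ n 1) * (+ n) * δs n)
    × ((n : ℕ) → 1 ≤ n →
    sumFrom1 n (λ k → (σo k Data.Integer.- σe k) * δt (n ∸ k))
    ≡ (+ n) * δt n)
    × ((n : ℕ) → 2 ≤ n →
    σ n + σs n + (+ 2) * sumFrom1 n (λ k → sgn k * δs k * (σ (n ∸ k) + σs (n ∸ k)))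
    ≡ (+ 2) * sgn (Data.Nat._+_ n 1) * (+ n) * δs n)
theorem5 =
  σ+σo-convolution , (λ n _ → σo-σe-convolution n) , (λ n 2≤n → σ+σs-convolution n (ℕ.<⇒≤ 2≤n))
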